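{- Let $p\neq 2,5$ be a prime, let $K$ be the perfect closure of $\mathbb F_p(t)$, and let $C^-$ be the genus-$2$ curve $y^2=x^5-5x^3+5x+2-4t$ over $K$. Let $M$ be the Cartier–Manin matrix of $C^-$ with respect to the basis $\{dx/y,\ x\,dx/y\}$ of $H^0(C^-,\Omega^1)$. Then $$M=\begin{pmatrix}*&0\\0&*\end{pmatrix}\ \text{ if } p\equiv 1,4\pmod 5,\qquad M=\begin{pmatrix}0&*\\ *&0\end{pmatrix}\ \text{ if } p\equiv 2,3\pmod 5,$$ where the entries of $M^{(p)}$ lie in $\mathbb F_p[t]$.
   Context: The Cartier operator on $H^0(C,\Omega^1_C)$ is defined by $\mathscr C(d\varphi+\eta^p x^{p-1}dx)=\eta\,dx$ (every differential can be written in this form); it is $1/p$-linear. The Cartier–Manin matrix is its matrix with respect to a chosen basis (column $j$ = coordinates of the image of the $j$-th basis vector). $M^{(p)}$ denotes the matrix obtained by raising each entry of $M$ to the $p$-th power. -}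

module Defs where

open import Algebra.Bundles using (CommutativeRing; Semiring)
open import Algebra.Morphism.Structures using (module RingMorphisms)
import Algebra.Definitions.RawSemiring as RawSemiringOps
open import Data.Fin using (Fin)
open import Data.Fin.Patterns using (0F; 1F)
open import Data.List using (List; foldr)
open import Data.List.Relation.Unary.All using (All)
open import Data.Nat using (ℕ; _∸_)
open import Data.Product using (∃; ∃-syntax; _×_)
open import Level using (Level; _⊔_; suc)
open import Relation.Binary.Definitions using (Decidable)
open import Relation.Nullary using (¬_)

-- Discrete fields.  The inverse is total for convenience: nothing is assumed
-- about 0# ⁻¹.  (The library's HeytingField allows fields whose equality is
-- undecidable; 𝔽ₚ(t), its perfect closure and function fields of curves over
-- the latter all have decidable equality.)
record Field (c ℓ : Level) : Set (suc (c ⊔ ℓ)) where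
  infix 9 _⁻¹
  field
    commutativeRing : CommutativeRing c ℓ
  open CommutativeRing commutativeRing public
  field
    _⁻¹      : Carrier → Carrier
    1≉0      : ¬ (1# ≈ 0#)
    inverseʳ : ∀ a → ¬ (a ≈ 0#) → a * a ⁻¹ ≈ 1#
    _≟_      : Decidable _≈_

  -- a ^ n, and the multiple n ⋆ a of a by a natural number n.
  open RawSemiringOps (Semiring.rawSemiring semiring) public using (_^_) renaming (_×_ to _⋆_)

  -- eval φ (a₀ ∷ a₁ ∷ …) z = φ a₀ + φ a₁ z + …
  eval : ∀ {a} {A : Set a} → (A → Carrier) → List A → Carrier → Carrier
  eval φ as z = foldr (λ a r → φ a + z * r) 0# as

  -- z is transcendental over the subfield which is the image of φ.
  Transcendental : ∀ {a} {A : Set a} → (A → Carrier) → Carrier → Set (a ⊔ ℓ)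
  Transcendental φ z = ∀ as → eval φ as z ≈ 0# → All (λ a → φ a ≈ 0#) as

  -- In characteristic p every element of the prime field 𝔽ₚ is n · 1 for some
  -- natural number n, so natural numbers serve as coefficients in 𝔽ₚ.
  fromℕ : ℕ → Carrier
  fromℕ n = n ⋆ 1#

  -- a ∈𝔽ₚ[ t ]: a lies in the subring generated by t over the prime field.
  infix 4 _∈𝔽ₚ[_]
  _∈𝔽ₚ[_] : Carrier → Carrier → Set ℓ
  a ∈𝔽ₚ[ t ] = ∃[ g ] eval fromℕ g t ≈ a

-- K, with its element t, is a perfect closure of 𝔽ₚ(t): a perfect field of
-- characteristic p that contains 𝔽ₚ(t) and is purely inseparable over it.
record IsPerfectClosure {c ℓ} (p : ℕ) (K : Field c ℓ) (t : Field.Carrier K)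
    : Set (c ⊔ ℓ) where
  open Field K
  field
    characteristic      : p ⋆ 1# ≈ 0#
    transcendental      : Transcendental fromℕ t
    perfect             : ∀ a → ∃[ b ] b ^ p ≈ a
    purelyInseparable   : ∀ a → ∃[ n ] ∃[ g ] ∃[ h ]
      (¬ (eval fromℕ h t ≈ 0#)) ×
      eval fromℕ h t * a ^ (p Data.Nat.^ n) ≈ eval fromℕ g t

-- The function field K(C⁻) of C⁻ : y² = x⁵ − 5x³ + 5x + 2 − 4t, i.e. the
-- fraction field of K[x , y] / (y² − f(x)).  As f has odd degree, y ∉ K(x), so
-- the equation is the minimal polynomial of y over K(x), and K(x) + K(x) y is
-- all of K(C⁻).
record FunctionField {c ℓ} (K : Field c ℓ) (t : Field.Carrier K) (c′ ℓ′ : Level)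
    : Set (c ⊔ ℓ ⊔ suc (c′ ⊔ ℓ′)) where
  private module K = Field K
  field
    F : Field c′ ℓ′
  open Field F
  open RingMorphisms K.rawRing rawRing using (IsRingHomomorphism)
  field
    ι                  : K.Carrier → Carrier
    ι-isHomomorphism   : IsRingHomomorphism ι
    x y                : Carrier
    x-transcendental   : Transcendental ι x
    equation           :
      y ^ 2 ≈ x ^ 5 - 5 ⋆ (x ^ 3) + 5 ⋆ x + 2 ⋆ 1# - 4 ⋆ ι t
    generated          : ∀ z → ∃[ a ] ∃[ b ] ∃[ d ]
      (¬ (eval ι d x ≈ 0#)) × eval ι d x * z ≈ eval ι a x + eval ι b x * y

-- The F-module Ω¹ of Kähler differentials of F over K, by generators and
-- relations; its equality is _≈Ω_.
module Kähler {c ℓ c′ ℓ′} (K : Field c ℓ) (F : Field c′ ℓ′)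
              (ι : Field.Carrier K → Field.Carrier F) where
  private
    module K = Field K
    module F = Field F

  infixl 6 _⊕_
  infixr 7 _·_
  infix  4 _≈Ω_

  data Ω : Set c′ where
    0Ω  : Ω
    _⊕_ : Ω → Ω → Ω
    _·_ : F.Carrier → Ω → Ω
    d   : F.Carrier → Ω

  data _≈Ω_ : Ω → Ω → Set (c ⊔ c′ ⊔ ℓ′) where
    ≈-refl       : ∀ {α} → α ≈Ω α
    ≈-sym        : ∀ {α β} → α ≈Ω β → β ≈Ω α
    ≈-trans      : ∀ {α β γ} → α ≈Ω β → β ≈Ω γ → α ≈Ω γ
    ⊕-cong       : ∀ {α α′ β β′} → α ≈Ω α′ → β ≈Ω β′ → α ⊕ β ≈Ω α′ ⊕ β′
    ·-cong       : ∀ {a b α β} → a F.≈ b → α ≈Ω β → a · α ≈Ω b · β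
    d-cong       : ∀ {a b} → a F.≈ b → d a ≈Ω d b
    ⊕-assoc      : ∀ α β γ → (α ⊕ β) ⊕ γ ≈Ω α ⊕ (β ⊕ γ)
    ⊕-comm       : ∀ α β → α ⊕ β ≈Ω β ⊕ α
    ⊕-identityʳ  : ∀ α → α ⊕ 0Ω ≈Ω α
    ·-distribˡ   : ∀ a α β → a · (α ⊕ β) ≈Ω a · α ⊕ a · β
    ·-distribʳ   : ∀ a b α → (a F.+ b) · α ≈Ω a · α ⊕ b · α
    ·-assoc      : ∀ a b α → (a F.* b) · α ≈Ω a · (b · α)
    ·-identity   : ∀ α → F.1# · α ≈Ω α
    ·-zero       : ∀ α → F.0# · α ≈Ω 0Ω
    d-+          : ∀ a b → d (a F.+ b) ≈Ω d a ⊕ d b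
    d-*          : ∀ a b → d (a F.* b) ≈Ω a · d b ⊕ b · d a
    d-constant   : ∀ k → d (ι k) ≈Ω 0Ω

module _ {c ℓ c′ ℓ′} {K : Field c ℓ} {t : Field.Carrier K}
         (p : ℕ) (C : FunctionField K t c′ ℓ′) where
  private module K = Field K
  open FunctionField C
  open Field F
  open Kähler K F ι

  -- The graph of the Cartier operator:
  -- IsCartierImage α β  means  𝒞 α = β,  where  𝒞 (dφ + ηᵖ xᵖ⁻¹ dx) = η dx.
  IsCartierImage : Ω → Ω → Set (c ⊔ c′ ⊔ ℓ′)
  IsCartierImage α β = ∃[ φ ] ∃[ η ]
    (α ≈Ω d φ ⊕ (η ^ p * x ^ (p ∸ 1)) · d x) × (β ≈Ω η · d x)

  -- The basis dx/y , x dx/y of H⁰(C⁻ , Ω¹), inside the differentials of K(C⁻).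
  basis : Fin 2 → Ω
  basis 0F = y ⁻¹ · d x
  basis 1F = (x * y ⁻¹) · d x

  -- Column j holds the coordinates of the image of the j-th basis vector.
  IsCartierManinMatrix : (Fin 2 → Fin 2 → K.Carrier) → Set (c ⊔ c′ ⊔ ℓ′)
  IsCartierManinMatrix M = ∀ j →
    IsCartierImage (basis j) (ι (M 0F j) · basis 0F ⊕ ι (M 1F j) · basis 1F)

module _ {c ℓ} (K : Field c ℓ) where
  open Field K

  IsDiagonal IsAntidiagonal : (Fin 2 → Fin 2 → Carrier) → Set ℓ
  IsDiagonal     M = M 0F 1F ≈ 0# × M 1F 0F ≈ 0#
  IsAntidiagonal M = M 0F 0F ≈ 0# × M 1F 1F ≈ 0#

  -- M ⁽ᵖ⁾
  entrywisePower : ℕ → (Fin 2 → Fin 2 → Carrier) → (Fin 2 → Fin 2 → Carrier)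
  entrywisePower p M i j = M i j ^ p

{-# OPTIONS --safe #-}

-- Put f = x⁵ − 5x³ + 5x + 2 − 4t and x = u + u⁻¹, so that f = u⁵ + u⁻⁵ + c with
-- c = 2 − 4t, and let W n = (uⁿ − u⁻ⁿ) / (u − u⁻¹), T n = uⁿ + u⁻ⁿ.  Since y² = f,
-- the basis vectors W 1 dx / y and W 2 dx / y are y⁻ᵖ times f ^ ((p − 1) / 2) W j dx.
-- Multiplication by u⁵ + u⁻⁵ shifts the index of W by ±5, so f ^ ((p − 1) / 2) W j is
-- a combination, over 𝔽ₚ[t], of those W n with n ≡ ±j (mod 5) and n < 3p.
-- As d(T n) = n W n dx, modulo exact differentials only W p dx ~ xᵖ⁻¹ dx and
-- W (2p) dx ~ x²ᵖ⁻¹ dx survive; W p occurs only if p ≡ ±j, and W (2p) only if 2p ≡ ±j.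
--
-- The Cartier operator is well defined because the derivation D = d/dx of K(C⁻)
-- satisfies Dᵖ = 0, while Dᵖ⁻¹(ηᵖ xᵖ⁻¹) = (p − 1)! ηᵖ determines η.

module Submission where

open import Defs
open import Algebra.Bundles using (CommutativeRing)
open import Algebra.Morphism.Structures using (module RingMorphisms)
import Algebra.Properties.CommutativeSemiring.Binomial
import Algebra.Properties.CommutativeSemiring.Exp
import Algebra.Properties.Monoid.Mult.TCOptimised
import Algebra.Properties.Ring
import Algebra.Properties.Semiring.Mult
import Algebra.Properties.Semiring.Mult.TCOptimised
import Algebra.Properties.Semiring.Sum
import Algebra.Solver.Ring
open import Algebra.Solver.Ring.AlmostCommutativeRing
  using (fromCommutativeRing; _-Raw-AlmostCommutative⟶_)
open import Data.Empty using (⊥-elim)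
open import Data.Fin using (Fin; zero; suc; inject₁)
import Data.Fin as Fin
open import Data.Fin.Patterns using (0F; 1F)
open import Data.Fin.Properties using (toℕ<n; toℕ-inject₁; toℕ-fromℕ)
open import Data.Integer using (ℤ; +_; -[1+_]; _⊖_)
import Data.Integer as ℤ
import Data.Integer.Properties as ℤ
open import Data.List using (List; []; _∷_; map)
open import Data.List.Relation.Unary.All using (All; []; _∷_)
open import Data.Maybe using (Maybe; just; nothing)
open import Data.Nat using (ℕ; zero; suc; _!; _∸_; _%_; z≤n; s≤s)
import Data.Nat as ℕ
open import Data.Nat.Combinatorics using (nCk≡n!/k![n-k]!; k![n∸k]!∣n!; nCn≡1)
  renaming (_C_ to _choose_)
open import Data.Nat.Coprimality using (Coprime; coprime-Bézout)
open import Data.Nat.Divisibility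
  using (_∣_; divides; _∣?_; m∣m*n; ∣⇒≤; ∣m+n∣m⇒∣n; ∣-refl)
open import Data.Nat.DivMod using (m/n*n≡m)
open import Data.Nat.GCD using (module Bézout)
open import Data.Nat.Primality
  using (Prime; euclidsLemma; prime⇒irreducible; prime⇒nonTrivial; prime⇒nonZero)
import Data.Nat.Properties as ℕ
open import Data.Nat.Solver using (module +-*-Solver)
open import Data.Product using (∃-syntax; Σ-syntax; _×_; _,_; proj₁; proj₂)
open import Data.Sum using (_⊎_; inj₁; inj₂)
open import Data.Unit using (⊤; tt)
open import Level using (_⊔_)
open import Relation.Binary.Bundles using (Setoid)
open import Relation.Binary.PropositionalEquality as ≡ using (_≡_; _≢_)
import Relation.Binary.Reasoning.Setoid
open import Relation.Nullary using (¬_; yes; no)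

-- The entries of M are p-th roots: modulo exact differentials, f ^ ((p - 1) / 2) W j dx becomes (a
-- + b xᵖ) xᵖ⁻¹ dx with a and b in 𝔽ₚ[t], which leads to η = (M₀ + M₁ x) / y with M₀ᵖ = a and M₁ᵖ =
-- b. Hence the perfect field, and a statement over 𝔽ₚ[t] about M ⁽ᵖ⁾ rather than M. The constant 3p
-- comes from 5 (p - 1) / 2 + 2 < 3p. The element u never occurs: `T` and `W` are polynomials in x
-- given by a recurrence, and W (-n) = - W n replaces negative indices, which is why indices are
-- classified mod 5 only up to sign. The obstacle is uniqueness. Ω is presented by generators and
-- relations, so two forms can be told apart only by mapping Ω elsewhere, here to F by means of a
-- derivation D. It has to be built: on K[x], then on K[x , y], then on fractions. An element has
-- many representations, so at each stage the derivative is a relation, whose values are unique by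
-- the transcendence of x.

-- The ring solver with integer coefficients

module IntegerSolver {c ℓ} (R : CommutativeRing c ℓ) where
  open CommutativeRing R
  open Algebra.Properties.Ring ring
  open Algebra.Properties.Semiring.Mult.TCOptimised semiring
    using (×-homo-+; ×1-homo-*) renaming (_×_ to _⋆′_)
  open Algebra.Properties.Monoid.Mult.TCOptimised +-monoid using (1+×)
  open Relation.Binary.Reasoning.Setoid setoid

  -- The optimised multiple makes `fromℤ (+ 1)` reduce to `1#` and not to `1# + 0#`, so that the
  -- solver constant `:1` denotes `1#` itself.
  fromℤ : ℤ → Carrier
  fromℤ (+ n)    = n ⋆′ 1#
  fromℤ -[1+ n ] = - (suc n ⋆′ 1#)

  private
    cancel-1 : ∀ a b → (1# + a) - (1# + b) ≈ a - b
    cancel-1 a b = begin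
      (1# + a) - (1# + b)      ≈⟨ +-congˡ (-‿+-comm 1# b) ⟨
      (1# + a) + (- 1# - b)    ≈⟨ +-assoc _ _ _ ⟨
      ((1# + a) - 1#) - b      ≈⟨ +-congʳ (+-congʳ (+-comm 1# a)) ⟩
      ((a + 1#) - 1#) - b      ≈⟨ +-congʳ (+-assoc a 1# (- 1#)) ⟩
      (a + (1# - 1#)) - b      ≈⟨ +-congʳ (+-congˡ (-‿inverseʳ 1#)) ⟩
      (a + 0#) - b             ≈⟨ +-congʳ (+-identityʳ a) ⟩
      a - b                    ∎

  fromℤ-⊖ : ∀ m n → fromℤ (m ⊖ n) ≈ m ⋆′ 1# - n ⋆′ 1#
  fromℤ-⊖ m       zero    rewrite ℤ.⊖-≥ {m} {0} z≤n =
    sym (trans (+-congˡ -0#≈0#) (+-identityʳ _))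
  fromℤ-⊖ zero    (suc n) = sym (+-identityˡ _)
  fromℤ-⊖ (suc m) (suc n) rewrite ℤ.[1+m]⊖[1+n]≡m⊖n m n = begin
    fromℤ (m ⊖ n)                      ≈⟨ fromℤ-⊖ m n ⟩
    m ⋆′ 1# - n ⋆′ 1#                  ≈⟨ cancel-1 _ _ ⟨
    (1# + m ⋆′ 1#) - (1# + n ⋆′ 1#)    ≈⟨ +-cong (1+× m 1#) (-‿cong (1+× n 1#)) ⟨
    suc m ⋆′ 1# - suc n ⋆′ 1#          ∎

  fromℤ-+ : ∀ i j → fromℤ (i ℤ.+ j) ≈ fromℤ i + fromℤ j
  fromℤ-+ (+ m)    (+ n)    = ×-homo-+ 1# m n
  fromℤ-+ (+ m)    -[1+ n ] = fromℤ-⊖ m (suc n)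
  fromℤ-+ -[1+ m ] (+ n)    = trans (fromℤ-⊖ n (suc m)) (+-comm _ _)
  fromℤ-+ -[1+ m ] -[1+ n ] = trans
    (-‿cong (trans (reflexive (≡.cong (λ k → suc k ⋆′ 1#) (≡.sym (ℕ.+-suc m n))))
      (×-homo-+ 1# (suc m) (suc n))))
    (sym (-‿+-comm _ _))

  fromℤ-neg : ∀ i → fromℤ (ℤ.- i) ≈ - fromℤ i
  fromℤ-neg (+ zero)  = sym -0#≈0#
  fromℤ-neg (+ suc n) = refl
  fromℤ-neg -[1+ n ]  = sym (-‿involutive _)

  fromℤ-* : ∀ i j → fromℤ (i ℤ.* j) ≈ fromℤ i * fromℤ j
  fromℤ-* (+ m)    (+ n)    rewrite ℤ.+◃n≡+n (m ℕ.* n) = ×1-homo-* m n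
  fromℤ-* (+ m)    -[1+ n ] rewrite ℤ.-◃n≡-n (m ℕ.* suc n) =
    trans (fromℤ-neg (+ (m ℕ.* suc n)))
      (trans (-‿cong (×1-homo-* m (suc n))) (-‿distribʳ-* _ _))
  fromℤ-* -[1+ m ] (+ n)    rewrite ℤ.-◃n≡-n (suc m ℕ.* n) =
    trans (fromℤ-neg (+ (suc m ℕ.* n)))
      (trans (-‿cong (×1-homo-* (suc m) n)) (-‿distribˡ-* _ _))
  fromℤ-* -[1+ m ] -[1+ n ] = begin
    (suc m ℕ.* suc n) ⋆′ 1#                ≈⟨ ×1-homo-* (suc m) (suc n) ⟩
    (suc m ⋆′ 1#) * (suc n ⋆′ 1#)          ≈⟨ -‿involutive _ ⟨
    - (- ((suc m ⋆′ 1#) * (suc n ⋆′ 1#)))  ≈⟨ -‿cong (-‿distribʳ-* _ _) ⟩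
    - ((suc m ⋆′ 1#) * - (suc n ⋆′ 1#))    ≈⟨ -‿distribˡ-* _ _ ⟩
    - (suc m ⋆′ 1#) * - (suc n ⋆′ 1#)      ∎

  private
    morphism : ℤ.+-*-rawRing -Raw-AlmostCommutative⟶ fromCommutativeRing R
    morphism = record
      { ⟦_⟧    = fromℤ
      ; +-homo = fromℤ-+
      ; *-homo = fromℤ-*
      ; -‿homo = fromℤ-neg
      ; 0-homo = refl
      ; 1-homo = refl
      }

    fromℤ-≟ : ∀ i j → Maybe (fromℤ i ≈ fromℤ j)
    fromℤ-≟ i j with i ℤ.≟ j
    ... | yes ≡.refl = just refl
    ... | no  _      = nothing

  open Algebra.Solver.Ring ℤ.+-*-rawRing (fromCommutativeRing R) morphism fromℤ-≟ public
    hiding (⟦_⟧; Env)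

-- Arithmetic in a discrete field

module FieldProperties {c ℓ} (K : Field c ℓ) where
  open Field K public hiding (zero)
  open Algebra.Properties.Ring ring public using (-0#≈0#)
  open Algebra.Properties.Semiring.Mult semiring public
    using (×-homo-+; ×-assocˡ; ×-assoc-*; ×-comm-*; ×1-homo-*; ×-congˡ; ×-congʳ)
  open Algebra.Properties.CommutativeSemiring.Exp commutativeSemiring public
    using (^-congˡ; ^-homo-*; ^-assocʳ; ^-distrib-*)
  open IntegerSolver commutativeRing public
    using (solve; _:+_; _:*_; _:-_; :-_; _:×_; _:^_; _:=_; con; Polynomial)
  open Relation.Binary.Reasoning.Setoid setoid

  :0 :1 : ∀ {n} → Polynomial n
  :0 = con (+ 0)
  :1 = con (+ 1)

  ≈⇒-≈0 : ∀ {a b} → a ≈ b → a - b ≈ 0#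
  ≈⇒-≈0 {a} {b} a≈b = trans (+-congʳ a≈b) (-‿inverseʳ b)

  -≈0⇒≈ : ∀ {a b} → a - b ≈ 0# → a ≈ b
  -≈0⇒≈ {a} {b} a-b≈0 = begin
    a            ≈⟨ solve 2 (λ a b → a := (a :- b) :+ b) refl a b ⟩
    (a - b) + b  ≈⟨ +-congʳ a-b≈0 ⟩
    0# + b       ≈⟨ +-identityˡ b ⟩
    b            ∎

  *≈0 : ∀ a {b} → b ≈ 0# → a * b ≈ 0#
  *≈0 a b≈0 = trans (*-congˡ b≈0) (zeroʳ a)

  +≈0 : ∀ {a b} → a ≈ 0# → b ≈ 0# → a + b ≈ 0#
  +≈0 a≈0 b≈0 = trans (+-cong a≈0 b≈0) (+-identityˡ 0#)

  neg≈0 : ∀ {a} → a ≈ 0# → - a ≈ 0#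
  neg≈0 a≈0 = trans (-‿cong a≈0) -0#≈0#

  inverseˡ : ∀ a → ¬ (a ≈ 0#) → a ⁻¹ * a ≈ 1#
  inverseˡ a a≉0 = trans (*-comm _ _) (inverseʳ a a≉0)

  *-cancelˡ-0 : ∀ {a b} → ¬ (a ≈ 0#) → a * b ≈ 0# → b ≈ 0#
  *-cancelˡ-0 {a} {b} a≉0 ab≈0 = begin
    b                ≈⟨ *-identityˡ b ⟨
    1# * b           ≈⟨ *-congʳ (inverseˡ a a≉0) ⟨
    a ⁻¹ * a * b     ≈⟨ *-assoc _ _ _ ⟩
    a ⁻¹ * (a * b)   ≈⟨ *≈0 _ ab≈0 ⟩
    0#               ∎

  *-cancelˡ : ∀ {a b c} → ¬ (a ≈ 0#) → a * b ≈ a * c → b ≈ c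
  *-cancelˡ {a} {b} {c} a≉0 ab≈ac = -≈0⇒≈ (*-cancelˡ-0 a≉0 (trans
    (solve 3 (λ a b c → a :* (b :- c) := a :* b :- a :* c) refl a b c) (≈⇒-≈0 ab≈ac)))

  *-≉0 : ∀ {a b} → ¬ (a ≈ 0#) → ¬ (b ≈ 0#) → ¬ (a * b ≈ 0#)
  *-≉0 a≉0 b≉0 ab≈0 = b≉0 (*-cancelˡ-0 a≉0 ab≈0)

  ^-≉0 : ∀ {a} n → ¬ (a ≈ 0#) → ¬ (a ^ n ≈ 0#)
  ^-≉0 zero    a≉0 = 1≉0
  ^-≉0 (suc n) a≉0 = *-≉0 a≉0 (^-≉0 n a≉0)

  ^-≈0 : ∀ {a} n → a ^ n ≈ 0# → a ≈ 0#
  ^-≈0 {a} n aⁿ≈0 with a ≟ 0#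
  ... | yes a≈0 = a≈0
  ... | no  a≉0 = ⊥-elim (^-≉0 n a≉0 aⁿ≈0)

  ⋆≈⋆1* : ∀ n a → n ⋆ a ≈ n ⋆ 1# * a
  ⋆≈⋆1* n a = trans (×-congʳ n (sym (*-identityˡ a))) (sym (×-assoc-* n 1# a))

-- Divisibility of factorials and binomial coefficients by a prime

module _ {p} (p-prime : Prime p) where
  prime∤⇒coprime : ∀ {n} → ¬ (p ∣ n) → Coprime p n
  prime∤⇒coprime p∤n (d∣p , d∣n) with prime⇒irreducible p-prime d∣p
  ... | inj₁ d≡1     = d≡1
  ... | inj₂ ≡.refl  = ⊥-elim (p∤n d∣n)

  prime∤! : ∀ {k} → k ℕ.< p → ¬ (p ∣ k !)
  prime∤! {zero}  0<p p∣1 = ℕ.<⇒≱ (ℕ.nonTrivial⇒n>1 p {{prime⇒nonTrivial p-prime}}) (∣⇒≤ p∣1)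
  prime∤! {suc k} k<p p∣k! with euclidsLemma (suc k) (k !) p-prime p∣k!
  ... | inj₁ p∣1+k = ℕ.<⇒≱ k<p (∣⇒≤ p∣1+k)
  ... | inj₂ p∣k!′ = prime∤! (ℕ.<-trans (ℕ.n<1+n k) k<p) p∣k!′

  -- p divides p!, the product of the binomial coefficient with k! and (p - k)!, and these two have
  -- only factors below p.
  prime∣C : ∀ {k} → 0 ℕ.< k → k ℕ.< p → p ∣ p choose k
  prime∣C {k} 0<k k<p with euclidsLemma (p choose k) (k ! ℕ.* (p ∸ k) !) p-prime
      (≡.subst (p ∣_) (≡.sym C*k![p-k]!≡p!) p∣p!)
    where
    instance
      _ = (k ℕ.!* (p ∸ k) !≢0)
    C*k![p-k]!≡p! : (p choose k) ℕ.* (k ! ℕ.* (p ∸ k) !) ≡ p !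
    C*k![p-k]!≡p! = ≡.trans (≡.cong (ℕ._* (k ! ℕ.* (p ∸ k) !)) (nCk≡n!/k![n-k]! (ℕ.<⇒≤ k<p)))
      (m/n*n≡m (k![n∸k]!∣n! (ℕ.<⇒≤ k<p)))
    n∣n! : ∀ {n} → 0 ℕ.< n → n ∣ n !
    n∣n! {suc n} _ = m∣m*n (n !)
    p∣p! : p ∣ p !
    p∣p! = n∣n! (ℕ.<-trans 0<k k<p)
  ... | inj₁ p∣C = p∣C
  ... | inj₂ p∣k![p-k]! with euclidsLemma (k !) ((p ∸ k) !) p-prime p∣k![p-k]!
  ...   | inj₁ p∣k!     = ⊥-elim (prime∤! k<p p∣k!)
  ...   | inj₂ p∣[p-k]! = ⊥-elim (prime∤! (ℕ.∸-monoʳ-< 0<k (ℕ.<⇒≤ k<p)) p∣[p-k]!)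

-- Fields of characteristic p and the Frobenius map

module Characteristic {c ℓ} (K : Field c ℓ) {p : ℕ} (p-prime : Prime p)
    (p⋆1≈0 : Field._≈_ K (Field._⋆_ K p (Field.1# K)) (Field.0# K)) where
  open FieldProperties K
  open Algebra.Properties.Semiring.Sum semiring
    using (sum; sum-cong-≋; sum-init-last; sum-replicate-zero)
  open Relation.Binary.Reasoning.Setoid setoid

  p⋆≈0 : ∀ a → p ⋆ a ≈ 0#
  p⋆≈0 a = trans (⋆≈⋆1* p a) (trans (*-congʳ p⋆1≈0) (zeroˡ a))

  p∣⇒⋆≈0 : ∀ {n} → p ∣ n → ∀ a → n ⋆ a ≈ 0#
  p∣⇒⋆≈0 {n} (divides q n≡qp) a = begin
    n ⋆ a            ≡⟨ ≡.cong (_⋆ a) (≡.trans n≡qp (ℕ.*-comm q p)) ⟩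
    (p ℕ.* q) ⋆ a    ≈⟨ ×-assocˡ a p q ⟨
    p ⋆ (q ⋆ a)      ≈⟨ p⋆≈0 _ ⟩
    0#               ∎

  -- A Bézout relation between p and n, read in the field, would give 1 = 0.
  p∤⇒⋆1≉0 : ∀ {n} → ¬ (p ∣ n) → ¬ (n ⋆ 1# ≈ 0#)
  p∤⇒⋆1≉0 {n} p∤n n⋆1≈0 = 1≉0 (1≈0 (coprime-Bézout (prime∤⇒coprime p-prime p∤n)))
    where
    multiple≈0 : ∀ u {v} → v ⋆ 1# ≈ 0# → (u ℕ.* v) ⋆ 1# ≈ 0#
    multiple≈0 u v≈0 = trans (×1-homo-* u _) (*≈0 _ v≈0)

    1≈ : ∀ {u v} → 1 ℕ.+ u ≡ v → u ⋆ 1# ≈ 0# → v ⋆ 1# ≈ 0# → 1# ≈ 0#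
    1≈ {u} {v} 1+u≡v u≈0 v≈0 = begin
      1#               ≈⟨ +-identityʳ 1# ⟨
      1# + 0#          ≈⟨ +-congˡ u≈0 ⟨
      (1 ℕ.+ u) ⋆ 1#   ≡⟨ ≡.cong (_⋆ 1#) 1+u≡v ⟩
      v ⋆ 1#           ≈⟨ v≈0 ⟩
      0#               ∎

    1≈0 : Bézout.Identity 1 p n → 1# ≈ 0#
    1≈0 (Bézout.+- u v eq) = 1≈ eq (multiple≈0 v n⋆1≈0) (multiple≈0 u p⋆1≈0)
    1≈0 (Bézout.-+ u v eq) = 1≈ eq (multiple≈0 u p⋆1≈0) (multiple≈0 v n⋆1≈0)

  frobenius-+ : ∀ a b → (a + b) ^ p ≈ a ^ p + b ^ p
  frobenius-+ a b = helper p ≡.refl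
    where
    open Algebra.Properties.CommutativeSemiring.Binomial commutativeSemiring
    -- `q` stands for `p` so that it can be matched against a successor; the binomial sum then
    -- splits off its two end terms.
    helper : ∀ q → q ≡ p → (a + b) ^ q ≈ a ^ q + b ^ q
    helper zero 0≡p = ⊥-elim (ℕ.<⇒≢ (ℕ.>-nonZero⁻¹ p {{prime⇒nonZero p-prime}}) 0≡p)
    helper q@(suc r) ≡.refl = begin
      (a + b) ^ q                        ≈⟨ theorem q a b ⟩
      term zero + sum (λ i → term (suc i))
        ≈⟨ +-congˡ (sum-init-last (λ i → term (suc i))) ⟩
      term zero + (sum (λ i → term (suc (inject₁ i))) + term (suc (Fin.fromℕ r)))
        ≈⟨ +-congˡ (+-congʳ (trans (sum-cong-≋ inner≈0) (sum-replicate-zero r))) ⟩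
      term zero + (0# + term (suc (Fin.fromℕ r)))  ≈⟨ +-cong first (trans
          (+-identityˡ _) last) ⟩
      b ^ q + a ^ q                      ≈⟨ +-comm _ _ ⟩
      a ^ q + b ^ q                      ∎
      where
      term = binomialTerm a b q
      inner≈0 : ∀ i → term (suc (inject₁ i)) ≈ 0#
      inner≈0 i = p∣⇒⋆≈0 (prime∣C p-prime (s≤s z≤n)
        (s≤s (≡.subst (ℕ._< r) (≡.sym (toℕ-inject₁ i)) (toℕ<n i)))) _
      first : term zero ≈ b ^ q
      first = trans (+-identityʳ _) (*-identityˡ _)
      last : term (suc (Fin.fromℕ r)) ≈ a ^ q
      last = top (≡.cong suc (toℕ-fromℕ r))
        where
        top : ∀ {k} → k ≡ q → (q choose k) ⋆ (a ^ k * b ^ (q ∸ k)) ≈ a ^ q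
        top ≡.refl = begin
          (q choose q) ⋆ (a ^ q * b ^ (q ∸ q))  ≈⟨ ×-congˡ (nCn≡1 q) ⟩
          1 ⋆ (a ^ q * b ^ (q ∸ q))        ≈⟨ +-identityʳ _ ⟩
          a ^ q * b ^ (q ∸ q)              ≡⟨ ≡.cong (λ k → a ^ q * b ^ k) (ℕ.n∸n≡0 q) ⟩
          a ^ q * 1#                       ≈⟨ *-identityʳ _ ⟩
          a ^ q                            ∎

  -- Additivity is applied to (a - b) + b, which avoids computing (-b)ᵖ; then a - b vanishes because
  -- a field has no nilpotents.
  frobenius-injective : ∀ {a b} → a ^ p ≈ b ^ p → a ≈ b
  frobenius-injective {a} {b} aᵖ≈bᵖ = -≈0⇒≈ (^-≈0 p (begin
    (a - b) ^ p  ≈⟨ solve 2 (λ c b → c := (c :+ b) :- b) refl ((a - b) ^ p) (b ^ p) ⟩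
    ((a - b) ^ p + b ^ p) - b ^ p  ≈⟨ +-congʳ (frobenius-+ (a - b) b) ⟨
    (a - b + b) ^ p - b ^ p
      ≈⟨ +-congʳ (^-congˡ p (solve 2 (λ a b → a :- b :+ b := a) refl a b)) ⟩
    a ^ p - b ^ p                  ≈⟨ ≈⇒-≈0 aᵖ≈bᵖ ⟩
    0#                             ∎))

-- Field homomorphisms and linear combinations over the constants

module FieldHomomorphism {c ℓ c′ ℓ′} (K : Field c ℓ) (F : Field c′ ℓ′)
    (ι : Field.Carrier K → Field.Carrier F)
    (ι-isHomomorphism : RingMorphisms.IsRingHomomorphism (Field.rawRing K) (Field.rawRing F) ι)
    where
  private module K = FieldProperties K
  open FieldProperties F
  open RingMorphisms.IsRingHomomorphism ι-isHomomorphism public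
    renaming (⟦⟧-cong to ι-cong; +-homo to ι-+; *-homo to ι-*; -‿homo to ι-neg;
              0#-homo to ι-0; 1#-homo to ι-1)
    using ()
  open Relation.Binary.Reasoning.Setoid setoid

  ι-⋆ : ∀ n a → ι (n K.⋆ a) ≈ n ⋆ ι a
  ι-⋆ zero    a = ι-0
  ι-⋆ (suc n) a = trans (ι-+ _ _) (+-congˡ (ι-⋆ n a))

  ι-⋆1 : ∀ n → ι (n K.⋆ K.1#) ≈ n ⋆ 1#
  ι-⋆1 n = trans (ι-⋆ n K.1#) (×-congʳ n ι-1)

  ι-^ : ∀ a n → ι (a K.^ n) ≈ ι a ^ n
  ι-^ a zero    = ι-1
  ι-^ a (suc n) = trans (ι-* _ _) (*-congˡ (ι-^ a n))

  ι≈0 : ∀ {a} → a K.≈ K.0# → ι a ≈ 0#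
  ι≈0 a≈0 = trans (ι-cong a≈0) ι-0

  ι-injective-0 : ∀ {a} → ι a ≈ 0# → a K.≈ K.0#
  ι-injective-0 {a} ιa≈0 with a K.≟ K.0#
  ... | yes a≈0 = a≈0
  ... | no  a≉0 with () ← 1≉0 (begin
    1#                ≈⟨ ι-1 ⟨
    ι K.1#            ≈⟨ ι-cong (K.inverseˡ a a≉0) ⟨
    ι (a K.⁻¹ K.* a)  ≈⟨ ι-* _ _ ⟩
    ι (a K.⁻¹) * ι a  ≈⟨ *≈0 _ ιa≈0 ⟩
    0#                ∎)

  -- The predicates sit on the individual summands, so that the arithmetic of the coefficients (`Q`)
  -- and congruences and bounds for the indices (`P`) survive every manipulation. Indices may
  -- repeat; `reduction` adds up the coefficients of index p and of index 2p.
  data Span {q r} (Q : K.Carrier → Set q) (v : ℕ → Carrier) (P : ℕ → Set r)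
      : Carrier → Set (c ⊔ c′ ⊔ ℓ′ ⊔ q ⊔ r) where
    nil  : ∀ {z} → z ≈ 0# → Span Q v P z
    cons : ∀ {a n z z′} → Q a → P n → Span Q v P z → z′ ≈ ι a * v n + z → Span Q v P z′

  module _ {q} {Q : K.Carrier → Set q} {v : ℕ → Carrier} where
    span-≈ : ∀ {r} {P : ℕ → Set r} {z z′} → z′ ≈ z → Span Q v P z → Span Q v P z′
    span-≈ z′≈z (nil z≈0)             = nil (trans z′≈z z≈0)
    span-≈ z′≈z (cons qa pn s z≈a+w)  = cons qa pn s (trans z′≈z z≈a+w)

    span-+ : ∀ {r} {P : ℕ → Set r} {z z′} → Span Q v P z → Span Q v P z′ → Span Q v P (z + z′)
    span-+ (nil z≈0) s′ = span-≈ (trans (+-congʳ z≈0) (+-identityˡ _)) s′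
    span-+ (cons qa pn s z≈a+w) s′ =
      cons qa pn (span-+ s s′) (trans (+-congʳ z≈a+w) (+-assoc _ _ _))

    span-* : ∀ {r r′} {P : ℕ → Set r} {P′ : ℕ → Set r′} w →
      (∀ {a n} → Q a → P n → Span Q v P′ (w * (ι a * v n))) →
      ∀ {z} → Span Q v P z → Span Q v P′ (w * z)
    span-* w w* (nil z≈0) = nil (*≈0 w z≈0)
    span-* w w* (cons qa pn s z≈a+w) =
      span-≈ (trans (*-congˡ z≈a+w) (distribˡ _ _ _)) (span-+ (w* qa pn) (span-* w w* s))

-- Dickson polynomials

module Dickson {c ℓ} (F : Field c ℓ) (x : Field.Carrier F) where
  open FieldProperties F
  open Relation.Binary.Reasoning.Setoid setoid

  -- If x = u + u⁻¹ then T n = uⁿ + u⁻ⁿ and W n = (uⁿ − u⁻ⁿ) / (u − u⁻¹).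
  T W : ℕ → Carrier
  T 0             = 2 ⋆ 1#
  T 1             = x
  T (suc (suc n)) = x * T (suc n) - T n
  W 0             = 0#
  W 1             = 1#
  W (suc (suc n)) = x * W (suc n) - W n

  -- (uⁿ + u⁻ⁿ)(uᵐ - u⁻ᵐ) = (uⁿ⁺ᵐ - u⁻ⁿ⁻ᵐ) + (uᵏ - u⁻ᵏ) for k = m - n; `k` is supplied as a natural
  -- number to avoid subtraction.
  T*W : ∀ n {k m} → n ℕ.+ k ≡ m → T n * W m ≈ W (n ℕ.+ m) + W k
  T*W 0 {k} ≡.refl = solve 1 (λ w → (2 :× :1) :* w := w :+ w) refl (W k)
  T*W 1 {k} ≡.refl =
    solve 3 (λ x w w′ → x :* w′ := (x :* w′ :- w) :+ w) refl x (W k) (W (suc k))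
  T*W (suc (suc n)) {k} {m} 2+n+k≡m = begin
    (x * T (suc n) - T n) * W m
      ≈⟨ solve 4 (λ x t t′ w → (x :* t′ :- t) :* w := x :* (t′ :* w) :- t :* w)
           refl x (T n) (T (suc n)) (W m) ⟩
    x * (T (suc n) * W m) - T n * W m
      ≈⟨ +-cong (*-congˡ (T*W (suc n) {suc k} (≡.trans (≡.cong suc (ℕ.+-suc n k)) 2+n+k≡m)))
           (-‿cong (T*W n {suc (suc k)} (≡.trans (≡.trans (ℕ.+-suc n (suc k)) (≡.cong suc
               (ℕ.+-suc n k))) 2+n+k≡m))) ⟩
    x * (W (suc n ℕ.+ m) + W (suc k)) - (W (n ℕ.+ m) + W (suc (suc k)))
      ≈⟨ solve 5 (λ x u u′ w w′ → x :* (u′ :+ w′) :- (u :+ (x :* w′ :- w))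
                               := (x :* u′ :- u) :+ w)
           refl x (W (n ℕ.+ m)) (W (suc n ℕ.+ m)) (W k) (W (suc k)) ⟩
    W (suc (suc n) ℕ.+ m) + W k  ∎

  -- (u - u⁻¹)(uⁿ⁺¹ + u⁻ⁿ⁻¹) = (uⁿ⁺² - u⁻ⁿ⁻²) - (uⁿ - u⁻ⁿ).
  T≈W-W : ∀ n → T (suc n) ≈ W (suc (suc n)) - W n
  T≈W-W 0 = solve 1 (λ x → x := (x :* :1 :- :0) :- :0) refl x
  T≈W-W 1 = solve 1 (λ x → x :* x :- (2 :× :1) :=
    (x :* (x :* :1 :- :0) :- :1) :- :1) refl x
  T≈W-W (suc (suc n)) = begin
    x * T (suc (suc n)) - T (suc n)
      ≈⟨ +-cong (*-congˡ (T≈W-W (suc n))) (-‿cong (T≈W-W n)) ⟩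
    x * (W (suc (suc (suc n))) - W (suc n)) - (W (suc (suc n)) - W n)
      ≈⟨ solve 5 (λ x a b c d → x :* (d :- b) :- (c :- a) := (x :* d :- c) :- (x :* b :- a))
           refl x (W n) (W (suc n)) (W (suc (suc n))) (W (suc (suc (suc n)))) ⟩
    W (suc (suc (suc (suc n)))) - W (suc (suc n))  ∎

  private
    :T :W : ∀ {n} → Polynomial n → ℕ → Polynomial n
    :T x 0             = 2 :× :1
    :T x 1             = x
    :T x (suc (suc n)) = x :* :T x (suc n) :- :T x n
    :W x 0             = :0
    :W x 1             = :1
    :W x (suc (suc n)) = x :* :W x (suc n) :- :W x n

  T₅ : T 5 ≈ x ^ 5 - 5 ⋆ (x ^ 3) + 5 ⋆ x
  T₅ = solve 1 (λ x → :T x 5 := x :^ 5 :- (5 :× (x :^ 3)) :+ (5 :× x)) refl x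

  -- The indices 1 to 4 are treated one by one: there the product formula would call for W (n - 5) =
  -- - W (5 - n).
  T₅*W₁ : T 5 * W 1 ≈ W 6 - W 4
  T₅*W₁ = solve 1 (λ x → :T x 5 :* :W x 1 := :W x 6 :- :W x 4) refl x

  T₅*W₂ : T 5 * W 2 ≈ W 7 - W 3
  T₅*W₂ = solve 1 (λ x → :T x 5 :* :W x 2 := :W x 7 :- :W x 3) refl x

  T₅*W₃ : T 5 * W 3 ≈ W 8 - W 2
  T₅*W₃ = solve 1 (λ x → :T x 5 :* :W x 3 := :W x 8 :- :W x 2) refl x

  T₅*W₄ : T 5 * W 4 ≈ W 9 - W 1
  T₅*W₄ = solve 1 (λ x → :T x 5 :* :W x 4 := :W x 9 :- :W x 1) refl x

-- The class of n in (ℤ / 5) / ±1, represented by 0, 1 or 2.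
class : ℕ → ℕ
class 0 = 0
class 1 = 1
class 2 = 2
class 3 = 2
class 4 = 1
class (suc (suc (suc (suc (suc n))))) = class n

class-% : ∀ n → class n ≡ class (n % 5)
class-% 0 = ≡.refl
class-% 1 = ≡.refl
class-% 2 = ≡.refl
class-% 3 = ≡.refl
class-% 4 = ≡.refl
class-% (suc (suc (suc (suc (suc n))))) = class-% n

class-double : ∀ n → class (n ℕ.+ n) ≡ class (class n ℕ.+ class n)
class-double 0 = ≡.refl
class-double 1 = ≡.refl
class-double 2 = ≡.refl
class-double 3 = ≡.refl
class-double 4 = ≡.refl
class-double (suc (suc (suc (suc (suc n))))) = ≡.trans
  (≡.cong class (≡.trans (≡.sym (ℕ.+-assoc n 5 n)) (≡.cong (ℕ._+ n) (ℕ.+-comm n 5))))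
  (class-double n)

-- The subring 𝔽ₚ[t]

module PrimeSubring {c ℓ} (K : Field c ℓ) {p : ℕ} (p-prime : Prime p)
    (p⋆1≈0 : Field._≈_ K (Field._⋆_ K p (Field.1# K)) (Field.0# K))
    (t : Field.Carrier K) where
  open FieldProperties K
  open Characteristic K p-prime p⋆1≈0
  open Relation.Binary.Reasoning.Setoid setoid

  private
    _∔_ : List ℕ → List ℕ → List ℕ
    []      ∔ h       = h
    (m ∷ g) ∔ []      = m ∷ g
    (m ∷ g) ∔ (n ∷ h) = (m ℕ.+ n) ∷ (g ∔ h)

    eval-∔ : ∀ g h → eval fromℕ (g ∔ h) t ≈ eval fromℕ g t + eval fromℕ h t
    eval-∔ []      h       = sym (+-identityˡ _)
    eval-∔ (m ∷ g) []      = sym (+-identityʳ _)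
    eval-∔ (m ∷ g) (n ∷ h) = trans
      (+-cong (×-homo-+ 1# m n) (*-congˡ (eval-∔ g h)))
      (solve 5 (λ m n t g h → (m :+ n) :+ t :* (g :+ h) := (m :+ t :* g) :+ (n :+ t :* h))
        refl (fromℕ m) (fromℕ n) t _ _)

    eval-scale : ∀ k g → eval fromℕ (map (k ℕ.*_) g) t ≈ fromℕ k * eval fromℕ g t
    eval-scale k []      = sym (zeroʳ _)
    eval-scale k (n ∷ g) = trans
      (+-cong (×1-homo-* k n) (*-congˡ (eval-scale k g)))
      (solve 4 (λ k n t g → k :* n :+ t :* (k :* g) := k :* (n :+ t :* g))
        refl (fromℕ k) (fromℕ n) t _)

  ∈-≈ : ∀ {a b} → a ≈ b → a ∈𝔽ₚ[ t ] → b ∈𝔽ₚ[ t ]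
  ∈-≈ a≈b (g , g≈a) = g , trans g≈a a≈b

  0∈ : 0# ∈𝔽ₚ[ t ]
  0∈ = [] , refl

  1∈ : 1# ∈𝔽ₚ[ t ]
  1∈ = 1 ∷ [] , solve 1 (λ t → (:1 :+ :0) :+ t :* :0 := :1) refl t

  +-∈ : ∀ {a b} → a ∈𝔽ₚ[ t ] → b ∈𝔽ₚ[ t ] → (a + b) ∈𝔽ₚ[ t ]
  +-∈ (g , g≈a) (h , h≈b) = g ∔ h , trans (eval-∔ g h) (+-cong g≈a h≈b)

  t*-∈ : ∀ {a} → a ∈𝔽ₚ[ t ] → (t * a) ∈𝔽ₚ[ t ]
  t*-∈ (g , g≈a) = 0 ∷ g , trans (+-identityˡ _) (*-congˡ g≈a)

  ⋆-∈ : ∀ n {a} → a ∈𝔽ₚ[ t ] → (n ⋆ a) ∈𝔽ₚ[ t ]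
  ⋆-∈ zero    a∈ = 0∈
  ⋆-∈ (suc n) a∈ = +-∈ a∈ (⋆-∈ n a∈)

  -- Coefficients are natural numbers, so a sign is realised as the multiple p - 1.
  neg-∈ : ∀ {a} → a ∈𝔽ₚ[ t ] → (- a) ∈𝔽ₚ[ t ]
  neg-∈ {a} a∈ = ∈-≈ eq (⋆-∈ (ℕ.pred p) a∈)
    where
    eq : ℕ.pred p ⋆ a ≈ - a
    eq = -≈0⇒≈ (begin
      ℕ.pred p ⋆ a - - a     ≈⟨ solve 2 (λ a b → b :- :- a := a :+ b) refl a _ ⟩
      suc (ℕ.pred p) ⋆ a     ≡⟨ ≡.cong (_⋆ a) (ℕ.suc-pred p {{prime⇒nonZero p-prime}}) ⟩
      p ⋆ a                  ≈⟨ p⋆≈0 a ⟩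
      0#                     ∎)

half : ∀ n → ∃[ m ] (n ≡ m ℕ.+ m ⊎ n ≡ suc (m ℕ.+ m))
half zero = 0 , inj₁ ≡.refl
half (suc n) with half n
... | m , inj₁ ≡.refl = m , inj₂ ≡.refl
... | m , inj₂ ≡.refl = suc m , inj₁ (≡.cong suc (≡.sym (ℕ.+-suc m m)))

odd-prime : ∀ {p} → Prime p → p ≢ 2 → ∃[ m ] p ≡ suc (m ℕ.+ m)
odd-prime {p} p-prime p≢2 with half p
... | m , inj₂ p≡1+2m = m , p≡1+2m
... | m , inj₁ p≡2m with prime⇒irreducible p-prime (divides m p≡m*2)
    where
    p≡m*2 : p ≡ m ℕ.* 2
    p≡m*2 = ≡.trans p≡2m
      (≡.trans (≡.cong (m ℕ.+_) (≡.sym (ℕ.+-identityʳ m))) (ℕ.*-comm 2 m))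
...   | inj₂ 2≡p = ⊥-elim (p≢2 (≡.sym 2≡p))

-- Exact differentials

module Exactness {c ℓ c′ ℓ′} {K : Field c ℓ} {t : Field.Carrier K} {p : ℕ}
    (p-prime : Prime p) (p⋆1≈0 : Field._≈_ K (Field._⋆_ K p (Field.1# K)) (Field.0# K))
    (C : FunctionField K t c′ ℓ′) where
  private module K = FieldProperties K
  open FunctionField C public hiding (F)
  open FunctionField C using (F)
  open FieldProperties F public
  open FieldHomomorphism K F ι ι-isHomomorphism public
  open Dickson F x public
  open Kähler K F ι public

  p⋆1≈0′ : p ⋆ 1# ≈ 0#
  p⋆1≈0′ = trans (sym (ι-⋆1 p)) (ι≈0 p⋆1≈0)

  module CharK = Characteristic K p-prime p⋆1≈0
  open Characteristic F p-prime p⋆1≈0′ public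

  Ω-setoid : Setoid _ _
  Ω-setoid = record
    { Carrier = Ω ; _≈_ = _≈Ω_
    ; isEquivalence = record { refl = ≈-refl ; sym = ≈-sym ; trans = ≈-trans } }

  private module ≈R = Relation.Binary.Reasoning.Setoid setoid
  private module ΩR = Relation.Binary.Reasoning.Setoid Ω-setoid

  -- A relation in Ω, so that existence rests only on the rules for differentials; the function `D`
  -- on F appears only for uniqueness.
  HasDerivative : Carrier → Carrier → Set _
  HasDerivative φ z = d φ ≈Ω z · d x

  derivative-≈ : ∀ {φ z z′} → z ≈ z′ → HasDerivative φ z → HasDerivative φ z′
  derivative-≈ z≈z′ dφ = ≈-trans dφ (·-cong z≈z′ ≈-refl)

  derivative-constant : ∀ a → HasDerivative (ι a) 0#
  derivative-constant a = ≈-trans (d-constant a) (≈-sym (·-zero _))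

  derivative-0 : HasDerivative 0# 0#
  derivative-0 = ≈-trans (d-cong (sym ι-0)) (derivative-constant K.0#)

  derivative-x : HasDerivative x 1#
  derivative-x = ≈-sym (·-identity _)

  derivative-+ : ∀ {φ ψ z w} → HasDerivative φ z → HasDerivative ψ w →
      HasDerivative (φ + ψ) (z + w)
  derivative-+ dφ dψ = ≈-trans (d-+ _ _) (≈-trans (⊕-cong dφ dψ) (≈-sym (·-distribʳ _ _ _)))

  derivative-* : ∀ {φ ψ z w} → HasDerivative φ z → HasDerivative ψ w →
    HasDerivative (φ * ψ) (φ * w + ψ * z)
  derivative-* {φ} {ψ} {z} {w} dφ dψ = let open ΩR in begin
    d (φ * ψ)                           ≈⟨ d-* φ ψ ⟩
    φ · d ψ ⊕ ψ · d φ                   ≈⟨ ⊕-cong (·-cong refl dψ) (·-cong refl dφ) ⟩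
    φ · (w · d x) ⊕ ψ · (z · d x)       ≈⟨ ⊕-cong (·-assoc _ _ _) (·-assoc _ _ _) ⟨
    (φ * w) · d x ⊕ (ψ * z) · d x       ≈⟨ ·-distribʳ _ _ _ ⟨
    (φ * w + ψ * z) · d x               ∎

  derivative-ι* : ∀ a {φ z} → HasDerivative φ z → HasDerivative (ι a * φ) (ι a * z)
  derivative-ι* a dφ = derivative-≈ (trans (+-congˡ (zeroʳ _)) (+-identityʳ _))
    (derivative-* (derivative-constant a) dφ)

  derivative-x^ : ∀ n → HasDerivative (x ^ suc n) (suc n ⋆ 1# * x ^ n)
  derivative-x^ zero = derivative-≈
    (solve 1 (λ x → x :* :0 :+ :1 :* :1 := (:1 :+ :0) :* :1) refl x)
    (derivative-* derivative-x (≈-trans (d-cong (sym ι-1)) (derivative-constant K.1#)))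
  derivative-x^ (suc n) = derivative-≈
    (solve 3 (λ x k w → x :* (k :* w) :+ x :* w :* :1 := (:1 :+ k) :* (x :* w))
      refl x (suc n ⋆ 1#) (x ^ n))
    (derivative-* derivative-x (derivative-x^ n))

  -- T n = T (n − 1) x − T (n − 2), and T (n − 1) = x W (n − 1) − 2 W (n − 2).
  derivative-T : ∀ n → HasDerivative (T n) (n ⋆ 1# * W n)
  derivative-T 0 = derivative-≈ (sym (zeroˡ _))
    (≈-trans (d-cong (sym (ι-⋆1 2))) (derivative-constant _))
  derivative-T 1 = derivative-≈ (solve 0 (:1 := (:1 :+ :0) :* :1) refl) derivative-x
  derivative-T (suc (suc n)) = derivative-≈ eq
    (derivative-+ (derivative-* derivative-x (derivative-T (suc n))) derivative-neg)
    where
    derivative-neg : HasDerivative (- T n) (- (n ⋆ 1# * W n))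
    derivative-neg = ≈-trans (d-cong (neg≈ _)) (derivative-≈ (sym (neg≈ _))
      (derivative-ι* (K.- K.1#) (derivative-T n)))
      where
      neg≈ : ∀ a → - a ≈ ι (K.- K.1#) * a
      neg≈ a = trans (solve 1 (λ a → :- a := :- :1 :* a) refl a)
        (*-congʳ (sym (trans (ι-neg _) (-‿cong ι-1))))
    eq : x * (suc n ⋆ 1# * W (suc n)) + T (suc n) * 1# - n ⋆ 1# * W n ≈
         suc (suc n) ⋆ 1# * W (suc (suc n))
    eq = trans (+-congʳ (+-congˡ (*-congʳ (T≈W-W n))))
      (solve 4 (λ x k w w′ → x :* ((:1 :+ k) :* w′) :+ (x :* w′ :- w :- w) :* :1 :- k :* w
                          := (:1 :+ (:1 :+ k)) :* (x :* w′ :- w))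
        refl x (n ⋆ 1#) (W n) (W (suc n)))

  -- d(gᵖ) = p gᵖ⁻¹ dg. For general g no expression of dg as a multiple of dx is at hand, so the
  -- computation passes through `0Ω`.
  derivative-^p : ∀ g → HasDerivative (g ^ p) 0#
  derivative-^p g = helper p p⋆≈0
    where
    d-^ : ∀ n → d (g ^ suc n) ≈Ω (suc n ⋆ g ^ n) · d g
    d-^ zero = let open ΩR in begin
      d (g * 1#)              ≈⟨ d-cong (*-identityʳ g) ⟩
      d g                     ≈⟨ ·-identity _ ⟨
      1# · d g                ≈⟨ ·-cong (+-identityʳ 1#) ≈-refl ⟨
      (1# + 0#) · d g         ∎
    d-^ (suc n) = let open ΩR in begin
      d (g * g ^ suc n)                                     ≈⟨ d-* _ _ ⟩
      g · d (g ^ suc n) ⊕ g ^ suc n · d g                   ≈⟨ ⊕-cong (·-cong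
          refl (d-^ n)) ≈-refl ⟩
      g · ((suc n ⋆ g ^ n) · d g) ⊕ g ^ suc n · d g         ≈⟨ ⊕-cong (·-assoc _ _ _) ≈-refl ⟨
      (g * (suc n ⋆ g ^ n)) · d g ⊕ g ^ suc n · d g         ≈⟨ ·-distribʳ _ _ _ ⟨
      (g * (suc n ⋆ g ^ n) + g ^ suc n) · d g
        ≈⟨ ·-cong (trans (+-comm _ _) (+-congˡ (×-comm-* (suc n) g (g ^ n)))) ≈-refl ⟩
      (suc (suc n) ⋆ g ^ suc n) · d g                       ∎

    helper : ∀ n → (∀ a → n ⋆ a ≈ 0#) → HasDerivative (g ^ n) 0#
    helper zero    _     = ≈-trans (d-cong (sym ι-1)) (derivative-constant K.1#)
    helper (suc n) n⋆≈0  = let open ΩR in begin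
      d (g ^ suc n)             ≈⟨ d-^ n ⟩
      (suc n ⋆ g ^ n) · d g     ≈⟨ ·-cong (n⋆≈0 _) ≈-refl ⟩
      0# · d g                  ≈⟨ ·-zero _ ⟩
      0Ω                        ≈⟨ ·-zero _ ⟨
      0# · d x                  ∎

  Exact : Carrier → Set _
  Exact z = ∃[ φ ] HasDerivative φ z

  exact-≈ : ∀ {z z′} → z ≈ z′ → Exact z → Exact z′
  exact-≈ z≈z′ (φ , dφ) = φ , derivative-≈ z≈z′ dφ

  exact-0 : ∀ {z} → z ≈ 0# → Exact z
  exact-0 z≈0 = 0# , derivative-≈ (sym z≈0) derivative-0

  exact-+ : ∀ {z w} → Exact z → Exact w → Exact (z + w)
  exact-+ (φ , dφ) (ψ , dψ) = φ + ψ , derivative-+ dφ dψ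

  exact-ι* : ∀ a {z} → Exact z → Exact (ι a * z)
  exact-ι* a (φ , dφ) = ι a * φ , derivative-ι* a dφ

  -- An element with vanishing differential behaves like a constant; the cases of interest are y⁻ᵖ
  -- and T p.
  exact-* : ∀ {g} → HasDerivative g 0# → ∀ {z} → Exact z → Exact (g * z)
  exact-* {g} dg (φ , dφ) = g * φ , derivative-≈
    (trans (+-congˡ (zeroʳ _)) (+-identityʳ _)) (derivative-* dg dφ)

  exact-span : ∀ {q r} {Q : K.Carrier → Set q} {v : ℕ → Carrier} {P : ℕ → Set r} w →
    (∀ {n} → P n → Exact (w * v n)) → ∀ {z} → Span Q v P z → Exact (w * z)
  exact-span w exact (nil z≈0) = exact-0 (*≈0 w z≈0)
  exact-span {v = v} w exact (cons {a} {n} {z} qa pn s z≈) = exact-≈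
    (trans (solve 4 (λ w a v z → a :* (w :* v) :+ w :* z := w :* (a :* v :+ z))
        refl w (ι a) (v n) z)
      (*-congˡ (sym z≈)))
    (exact-+ (exact-ι* a (exact pn)) (exact-span w exact s))

  exact-unscale : ∀ {n z} → ¬ (p ∣ n) → Exact (n ⋆ 1# * z) → Exact z
  exact-unscale {n} {z} p∤n exact = exact-≈ (let open ≈R in begin
    ι k * (n ⋆ 1# * z)              ≈⟨ *-assoc _ _ _ ⟨
    ι k * n ⋆ 1# * z                ≈⟨ *-congʳ (*-congˡ (ι-⋆1 n)) ⟨
    ι k * ι (n K.⋆ K.1#) * z        ≈⟨ *-congʳ (ι-* _ _) ⟨
    ι (k K.* (n K.⋆ K.1#)) * z      ≈⟨ *-congʳ (ι-cong (K.inverseˡ _ (CharK.p∤⇒⋆1≉0 p∤n))) ⟩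
    ι K.1# * z                      ≈⟨ *-congʳ ι-1 ⟩
    1# * z                          ≈⟨ *-identityˡ z ⟩
    z                               ∎) (exact-ι* k exact)
    where k = (n K.⋆ K.1#) K.⁻¹

  exact-x^ : ∀ {n} → ¬ (p ∣ suc n) → Exact (x ^ n)
  exact-x^ {n} p∤1+n = exact-unscale p∤1+n (_ , derivative-x^ n)

  exact-W : ∀ {n} → ¬ (p ∣ n) → Exact (W n)
  exact-W {n} p∤n = exact-unscale p∤n (_ , derivative-T n)

  -- Powers xᵏ with k < n and k ≡ n (mod 2). Parity is recorded because `exact-W₂ₚ` has to exclude a
  -- constant term of T p; the coefficients are arbitrary, as only exactness is at stake.
  Lower : ℕ → Carrier → Set _
  Lower n = Span (λ _ → ⊤) (x ^_) (λ k → ∃[ j ] k ℕ.+ (suc j ℕ.+ suc j) ≡ n)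

  lower-recurrence : ∀ {n s s′} → Lower n (s - x ^ n) → Lower (suc n) (s′ - x ^ suc n) →
    Lower (suc (suc n)) (x * s′ - s - x ^ suc (suc n))
  lower-recurrence {n} {s} {s′} low low′ = span-≈
    (solve 4 (λ x s s′ w → x :* s′ :- s :- x :* (x :* w) :=
       x :* (s′ :- x :* w) :+ (:- :1 :* (s :- w) :+ :- :1 :* w)) refl x s s′ (x ^ n))
    (span-+ (span-* x shift low′) (span-+ (span-* (- 1#) neg low)
      -- The leading term xⁿ of `s`, two degrees below n + 2, enters with coefficient -1.
      (cons {a = K.- K.1#} tt (0 , ℕ.+-comm n 2) (nil refl)
        (trans (*-congʳ (sym (trans (ι-neg _) (-‿cong ι-1)))) (sym (+-identityʳ _))))))
    where
    shift : ∀ {a k} → ⊤ → (∃[ j ] k ℕ.+ (suc j ℕ.+ suc j) ≡ suc n) →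
        Lower (suc (suc n)) (x * (ι a * x ^ k))
    shift {a} {k} _ (j , k+2j≡1+n) = cons {a = a} {n = suc k} tt (j , ≡.cong suc k+2j≡1+n)
        (nil refl)
      (solve 3 (λ x a w → x :* (a :* w) := a :* (x :* w) :+ :0) refl x (ι a) (x ^ k))
    neg : ∀ {a k} → ⊤ → (∃[ j ] k ℕ.+ (suc j ℕ.+ suc j) ≡ n) →
        Lower (suc (suc n)) (- 1# * (ι a * x ^ k))
    neg {a} {k} _ (j , k+2j≡n) = cons {a = K.- a} {n = k} tt
      (suc j , ≡.trans (≡.cong (k ℕ.+_) (≡.cong suc (ℕ.+-suc (suc j) (suc j)))) (≡.trans
          (ℕ.+-suc k _) (≡.cong suc (≡.trans (ℕ.+-suc k _) (≡.cong suc k+2j≡n)))))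
      (nil refl)
      (trans (solve 2 (λ a w → :- :1 :* (a :* w) := :- a :* w :+ :0) refl (ι a) (x ^ k))
        (+-congʳ (*-congʳ (sym (ι-neg a)))))

  W-lower : ∀ n → Lower n (W (suc n) - x ^ n)
  W-lower 0 = nil (-‿inverseʳ 1#)
  W-lower 1 = nil (solve 1 (λ x → x :* :1 :- :0 :- x :* :1 := :0) refl x)
  W-lower (suc (suc n)) = lower-recurrence (W-lower n) (W-lower (suc n))

  -- The induction starts at T 1, since T 0 = 2 is not monic; the constant -2 of T 2 is therefore
  -- entered by hand.
  T-lower : ∀ n → Lower (suc n) (T (suc n) - x ^ suc n)
  T-lower 0 = nil (solve 1 (λ x → x :- x :* :1 := :0) refl x)
  T-lower 1 = cons {a = K.- (2 K.⋆ K.1#)} {n = 0} tt (0 , ≡.refl) (nil refl)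
    (trans (solve 1 (λ x → x :* x :- (2 :× :1) :- x :* (x :* :1) := :- (2 :× :1) :* :1 :+ :0)
        refl x)
      (+-congʳ (*-congʳ (sym (trans (ι-neg _) (-‿cong (ι-⋆1 2)))))))
  T-lower (suc (suc n)) = lower-recurrence (T-lower n) (T-lower (suc n))

  p∤ : ∀ {n} → 0 ℕ.< n → n ℕ.< p → ¬ (p ∣ n)
  p∤ {suc n} 0<n n<p p∣n = ℕ.<⇒≱ n<p (∣⇒≤ p∣n)

  -- Apart from xᵖ⁻¹, W p contains only powers xᵏ with k + 1 < p, and these can be integrated.
  exact-Wₚ : ∀ {e} → suc e ≡ p → Exact (W p - x ^ e)
  exact-Wₚ {e} ≡.refl = exact-≈ (*-identityˡ _) (exact-span 1#
    (λ { {k} (j , k+2j≡e) → exact-≈ (sym (*-identityˡ _)) (exact-x^ (p∤ (s≤s z≤n)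
      (s≤s (≡.subst (k ℕ.<_) k+2j≡e (ℕ.m<m+n k (s≤s z≤n)))))) })
    (W-lower e))

  -- W (2p) = T p · W p, and d(T p) = p W p dx = 0. Hence T p (W p - xᵖ⁻¹) is exact, and what
  -- remains is xᵖ⁻¹ (T p - xᵖ), a combination of powers xᵖ⁻¹⁺ᵏ with k < p.
  exact-W₂ₚ : ∀ {e m} → suc e ≡ p → p ≡ suc (m ℕ.+ m) → Exact (W (p ℕ.+ p) - x ^ p * x ^ e)
  exact-W₂ₚ {e} {m} ≡.refl p≡1+2m = exact-≈ (let open ≈R in begin
    T p * (W p - x ^ e) + x ^ e * (T p - x ^ p)
      ≈⟨ solve 4 (λ t w a b → t :* (w :- a) :+ a :* (t :- b) := t :* w :- b :* a)
          refl (T p) (W p) (x ^ e) (x ^ p) ⟩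
    T p * W p - x ^ p * x ^ e    ≈⟨ +-congʳ (trans (T*W p (ℕ.+-identityʳ p)) (+-identityʳ _)) ⟩
    W (p ℕ.+ p) - x ^ p * x ^ e  ∎)
    (exact-+ (exact-* dTₚ (exact-Wₚ ≡.refl)) (exact-span (x ^ e) exact (T-lower e)))
    where
    dTₚ : HasDerivative (T p) 0#
    dTₚ = derivative-≈ (trans (*-congʳ p⋆1≈0′) (zeroˡ _)) (derivative-T p)
    even≢odd : ∀ j k → j ℕ.+ j ≢ suc (k ℕ.+ k)
    even≢odd j k eq = ℕ.even≢odd j k (≡.trans (≡.cong (j ℕ.+_) (ℕ.+-identityʳ j))
      (≡.trans eq (≡.cong suc (≡.cong (k ℕ.+_) (≡.sym (ℕ.+-identityʳ k))))))
    exact : ∀ {k} → (∃[ j ] k ℕ.+ (suc j ℕ.+ suc j) ≡ p) → Exact (x ^ e * x ^ k)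
    -- The power xᵖ⁻¹ could not be integrated; k = 0 is excluded because p is odd.
    exact {zero}  (j , 2j≡p) = ⊥-elim (even≢odd (suc j) m (≡.trans 2j≡p p≡1+2m))
    exact {suc k} (j , k+2j≡p) = exact-≈ (^-homo-* x e (suc k)) (exact-x^ λ p∣ →
      p∤ (s≤s z≤n) (≡.subst (suc k ℕ.<_) k+2j≡p (ℕ.m<m+n (suc k) (s≤s z≤n)))
        (∣m+n∣m⇒∣n p∣ ∣-refl))

-- Existence of the matrix

module Existence {c ℓ c′ ℓ′} {K : Field c ℓ} {t : Field.Carrier K} {p : ℕ}
    (p-prime : Prime p) {m : ℕ} (p≡1+2m : p ≡ suc (m ℕ.+ m))
    (K-perfectClosure : IsPerfectClosure p K t)
    (C : FunctionField K t c′ ℓ′) where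
  private module K = FieldProperties K
  open IsPerfectClosure K-perfectClosure
  open Exactness p-prime characteristic C
  open PrimeSubring K p-prime characteristic t
  private module ≈R = Relation.Binary.Reasoning.Setoid setoid
  private module ΩR = Relation.Binary.Reasoning.Setoid Ω-setoid

  e = m ℕ.+ m

  1+e≡p : suc e ≡ p
  1+e≡p = ≡.sym p≡1+2m

  p∸1≡e : p ℕ.∸ 1 ≡ e
  p∸1≡e = ≡.cong (ℕ._∸ 1) p≡1+2m

  c₀ : K.Carrier
  c₀ = 2 K.⋆ K.1# K.- 4 K.⋆ t

  ι-c₀ : ι c₀ ≈ 2 ⋆ 1# - 4 ⋆ ι t
  ι-c₀ = trans (ι-+ _ _) (+-cong (ι-⋆1 2) (trans (ι-neg _) (-‿cong (ι-⋆ 4 t))))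

  y²≈ : y ^ 2 ≈ T 5 + ι c₀
  y²≈ = trans equation (trans
    (solve 3 (λ a b c → a :+ b :- c := a :+ (b :- c)) refl _ (2 ⋆ 1#) (4 ⋆ ι t))
    (+-cong (sym T₅) (sym ι-c₀)))

  WSpan : ℕ → ℕ → Carrier → Set _
  WSpan r N = Span (K._∈𝔽ₚ[ t ]) W (λ n → class n ≡ r × n ℕ.≤ N)

  -- W n goes to W (n + 5) + W (n - 5) + c₀ W n, where for n < 5 the middle term is - W (5 - n): all
  -- indices stay in the class of n.
  f*-span : ∀ {r N a n} → a K.∈𝔽ₚ[ t ] → class n ≡ r × n ℕ.≤ N →
    WSpan r (5 ℕ.+ N) ((T 5 + ι c₀) * (ι a * W n))
  f*-span {r} {N} {a} {n} a∈ = go n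
    where
    c₀a∈ : (c₀ K.* a) K.∈𝔽ₚ[ t ]
    c₀a∈ = ∈-≈ (K.solve 2 (λ t a → ((2 K.:× a) K.:- (4 K.:× (t K.:* a))) K.:=
        ((2 K.:× K.:1) K.:- (4 K.:× t)) K.:* a) K.refl t a)
      (+-∈ (⋆-∈ 2 a∈) (neg-∈ (⋆-∈ 4 (t*-∈ a∈))))

    -- `u` is the sign of the second term: 1 in general, -1 after a reflection.
    three : ∀ {n i j b u} → class i ≡ r × i ℕ.≤ 5 ℕ.+ N → class j ≡ r × j ℕ.≤ 5 ℕ.+ N →
        class n ≡ r × n ℕ.≤ 5 ℕ.+ N →
      b K.∈𝔽ₚ[ t ] → ι b ≈ u * ι a → T 5 * W n ≈ W i + u * W j →
      WSpan r (5 ℕ.+ N) ((T 5 + ι c₀) * (ι a * W n))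
    three {n} {i} {j} {b} {u} Pi Pj Pn b∈ ιb≈ T₅W≈ =
      cons a∈ Pi (cons b∈ Pj (cons c₀a∈ Pn (nil refl) refl) refl) (let open ≈R in begin
        (T 5 + ι c₀) * (ι a * W n)
          ≈⟨ solve 4 (λ t c a w → (t :+ c) :* (a :* w) := a :* (t :* w) :+ c :* a :* w)
              refl (T 5) (ι c₀) (ι a) (W n) ⟩
        ι a * (T 5 * W n) + ι c₀ * ι a * W n
          ≈⟨ +-cong (*-congˡ T₅W≈) (*-congʳ (sym (ι-* c₀ a))) ⟩
        ι a * (W i + u * W j) + ι (c₀ K.* a) * W n
          ≈⟨ solve 6 (λ a w u w′ k w″ → a :* (w :+ u :* w′) :+ k :* w″
              := a :* w :+ (u :* a :* w′ :+ (k :* w″ :+ :0)))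
               refl (ι a) (W i) u (W j) (ι (c₀ K.* a)) (W n) ⟩
        ι a * W i + (u * ι a * W j + (ι (c₀ K.* a) * W n + 0#))
          ≈⟨ +-congˡ (+-congʳ (*-congʳ ιb≈)) ⟨
        ι a * W i + (ι b * W j + (ι (c₀ K.* a) * W n + 0#)) ∎)

    reflect : ∀ {n i j} → class i ≡ r × i ℕ.≤ 5 ℕ.+ N → class j ≡ r × j ℕ.≤ 5 →
        class n ≡ r × n ℕ.≤ N →
      T 5 * W n ≈ W i - W j → WSpan r (5 ℕ.+ N) ((T 5 + ι c₀) * (ι a * W n))
    reflect Pi (cj , j≤5) (cn , n≤N) T₅W≈ = three {u = - 1#} Pi (cj , ℕ.≤-trans j≤5
        (ℕ.m≤m+n 5 N)) (cn , ℕ.≤-trans n≤N (ℕ.m≤n+m N 5)) (neg-∈ a∈)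
      (trans (ι-neg a) (solve 1 (λ a → :- a := :- :1 :* a) refl (ι a)))
      (trans T₅W≈ (+-congˡ (solve 1 (λ w → :- w := :- :1 :* w) refl _)))

    go : ∀ n → class n ≡ r × n ℕ.≤ N → WSpan r (5 ℕ.+ N) ((T 5 + ι c₀) * (ι a * W n))
    go 0 _ = nil (*≈0 _ (zeroʳ _))
    go 1 Pn@(cn , n≤N) = reflect (cn , ℕ.+-monoʳ-≤ 5 n≤N) (cn , ℕ.m≤m+n 4 1) Pn T₅*W₁
    go 2 Pn@(cn , n≤N) = reflect (cn , ℕ.+-monoʳ-≤ 5 n≤N) (cn , ℕ.m≤m+n 3 2) Pn T₅*W₂
    go 3 Pn@(cn , n≤N) = reflect (cn , ℕ.+-monoʳ-≤ 5 n≤N) (cn , ℕ.m≤m+n 2 3) Pn T₅*W₃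
    go 4 Pn@(cn , n≤N) = reflect (cn , ℕ.+-monoʳ-≤ 5 n≤N) (cn , ℕ.m≤m+n 1 4) Pn T₅*W₄
    go (suc (suc (suc (suc (suc n))))) (cn , n≤N) =
      three {u = 1#} (cn , ℕ.+-monoʳ-≤ 5 n≤N) (cn , ℕ.≤-trans (ℕ.m≤n+m n 5) n≤5+N)
          (cn , n≤5+N) a∈
        (sym (*-identityˡ _)) (trans (T*W 5 {n} ≡.refl) (+-congˡ (sym (*-identityˡ _))))
      where n≤5+N = ℕ.≤-trans n≤N (ℕ.m≤n+m N 5)

  f^-span : ∀ n i → WSpan (class i) (n ℕ.* 5 ℕ.+ i) ((T 5 + ι c₀) ^ n * W i)
  f^-span zero    i = cons 1∈ (≡.refl , ℕ.≤-refl) (nil refl)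
    (trans (*-congʳ (sym ι-1)) (sym (+-identityʳ _)))
  f^-span (suc n) i = span-≈ (*-assoc _ _ _) (span-* (T 5 + ι c₀) f*-span (f^-span n i))

  -- Below 3p the only indices divisible by p are 0, p and 2p. `a` collects the coefficients of W p
  -- and `b` those of W (2p); if p or 2p is not of class r, no summand has that index and the
  -- corresponding sum is empty.
  reduction : ∀ {r N z} → N ℕ.< 3 ℕ.* p → WSpan r N z →
    ∃[ a ] ∃[ b ] (a K.∈𝔽ₚ[ t ]) × (b K.∈𝔽ₚ[ t ])
      × (class p ≢ r → a K.≈ K.0#) × (class (p ℕ.+ p) ≢ r → b K.≈ K.0#)
      × Exact (z - (ι a + ι b * x ^ p) * x ^ e)
  reduction N<3p (nil {z} z≈0) = K.0# , K.0# , 0∈ , 0∈ , (λ _ → K.refl) , (λ _ → K.refl) ,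
    exact-0 (trans (+-cong z≈0 (-‿cong (*-congʳ (+-cong ι-0 (*-congʳ ι-0)))))
      (solve 2 (λ u w → :0 :- (:0 :+ :0 :* u) :* w := :0) refl (x ^ p) (x ^ e)))
  reduction {r} N<3p (cons {a₀} {n} {z} {z′} a₀∈ (cn , n≤N) s z′≈)
    with reduction N<3p s | p ∣? n
  ... | a , b , a∈ , b∈ , a≈0 , b≈0 , exact | no p∤n =
    a , b , a∈ , b∈ , a≈0 , b≈0 , exact-≈
      (trans (solve 3 (λ u z w → u :+ (z :- w) := u :+ z :- w)
          refl (ι a₀ * W n) z _) (+-congʳ (sym z′≈)))
      (exact-+ (exact-ι* a₀ (exact-W p∤n)) exact)
  -- p divides the index 0, but W 0 = 0 contributes nothing.
  ... | a , b , a∈ , b∈ , a≈0 , b≈0 , exact | yes (divides 0 ≡.refl) =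
    a , b , a∈ , b∈ , a≈0 , b≈0 , exact-≈
      (+-congʳ (trans (sym (trans (+-congʳ (zeroʳ _)) (+-identityˡ z))) (sym z′≈)))
      exact
  ... | a , b , a∈ , b∈ , a≈0 , b≈0 , exact | yes (divides 1 n≡p) =
    a₀ K.+ a , b , +-∈ a₀∈ a∈ , b∈ ,
    (λ p≢r → ⊥-elim (p≢r (≡.trans (≡.cong class p≡n) cn))) , b≈0 ,
    exact-≈ (let open ≈R in begin
      ι a₀ * (W p - x ^ e) + (z - (ι a + ι b * x ^ p) * x ^ e)
        ≈⟨ solve 7 (λ a₀ w u z a b v → a₀ :* (w :- u) :+ (z :- (a :+ b :* v) :* u)
                                    := a₀ :* w :+ z :- (a₀ :+ a :+ b :* v) :* u)
             refl (ι a₀) (W p) (x ^ e) z (ι a) (ι b) (x ^ p) ⟩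
      ι a₀ * W p + z - (ι a₀ + ι a + ι b * x ^ p) * x ^ e
        ≈⟨ +-cong (trans (+-congʳ (*-congˡ (reflexive (≡.cong W p≡n)))) (sym z′≈))
             (-‿cong (*-congʳ (+-congʳ (sym (ι-+ a₀ a))))) ⟩
      z′ - (ι (a₀ K.+ a) + ι b * x ^ p) * x ^ e  ∎)
    (exact-+ (exact-ι* a₀ (exact-Wₚ 1+e≡p)) exact)
    where
    p≡n : p ≡ n
    p≡n = ≡.sym (≡.trans n≡p (ℕ.*-identityˡ p))
  ... | a , b , a∈ , b∈ , a≈0 , b≈0 , exact | yes (divides 2 n≡2p) =
    a , a₀ K.+ b , a∈ , +-∈ a₀∈ b∈ ,
    a≈0 , (λ 2p≢r → ⊥-elim (2p≢r (≡.trans (≡.cong class 2p≡n) cn))) ,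
    exact-≈ (let open ≈R in begin
      ι a₀ * (W (p ℕ.+ p) - x ^ p * x ^ e) + (z - (ι a + ι b * x ^ p) * x ^ e)
        ≈⟨ solve 7 (λ a₀ w u z a b v → a₀ :* (w :- v :* u) :+ (z :- (a :+ b :* v) :* u)
                                    := a₀ :* w :+ z :- (a :+ (a₀ :+ b) :* v) :* u)
             refl (ι a₀) (W (p ℕ.+ p)) (x ^ e) z (ι a) (ι b) (x ^ p) ⟩
      ι a₀ * W (p ℕ.+ p) + z - (ι a + (ι a₀ + ι b) * x ^ p) * x ^ e
        ≈⟨ +-cong (trans (+-congʳ (*-congˡ (reflexive (≡.cong W 2p≡n)))) (sym z′≈))
             (-‿cong (*-congʳ (+-congˡ (*-congʳ (sym (ι-+ a₀ b)))))) ⟩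
      z′ - (ι a + ι (a₀ K.+ b) * x ^ p) * x ^ e  ∎)
    (exact-+ (exact-ι* a₀ (exact-W₂ₚ {m = m} 1+e≡p p≡1+2m)) exact)
    where
    2p≡n : p ℕ.+ p ≡ n
    2p≡n = ≡.sym (≡.trans n≡2p (≡.cong (p ℕ.+_) (ℕ.+-identityʳ p)))
  ... | _ | yes (divides (suc (suc (suc q))) n≡qp) = ⊥-elim (ℕ.<⇒≱ N<3p
    (ℕ.≤-trans (ℕ.*-monoˡ-≤ p (s≤s (s≤s (s≤s (z≤n {q}))))) (≡.subst (ℕ._≤ _) n≡qp n≤N)))

  -- 5m + 2 bounds the indices in fᵐ W 2, and 3p = 6m + 3.
  5m+2<3p : m ℕ.* 5 ℕ.+ 2 ℕ.< 3 ℕ.* p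
  5m+2<3p = ≡.subst (λ q → m ℕ.* 5 ℕ.+ 2 ℕ.< 3 ℕ.* q) 1+e≡p (ℕ.≤-trans (ℕ.≤-reflexive eq₁)
      (ℕ.≤-trans (ℕ.m≤m+n _ m) (ℕ.≤-reflexive eq₂)))
    where
    open +-*-Solver using () renaming
        (solve to ℕ-solve; _:+_ to _⊞_; _:*_ to _⊠_; con to #; _:=_ to _≐_)
    eq₁ : suc (m ℕ.* 5 ℕ.+ 2) ≡ 3 ℕ.+ m ℕ.* 5
    eq₁ = ≡.cong suc (ℕ.+-comm (m ℕ.* 5) 2)
    eq₂ : 3 ℕ.+ m ℕ.* 5 ℕ.+ m ≡ 3 ℕ.* suc (m ℕ.+ m)
    eq₂ = ℕ-solve 1 (λ m → # 3 ⊞ m ⊠ # 5 ⊞ m ≐ # 3 ⊠ (# 1 ⊞ (m ⊞ m))) ≡.refl m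

  -- Otherwise f(x) = 0, against the transcendence of x: the leading coefficient 1 cannot vanish.
  y≉0 : ¬ (y ≈ 0#)
  y≉0 y≈0 = contra (x-transcendental f-coeffs f≈0)
    where
    f-coeffs : List K.Carrier
    f-coeffs = c₀ ∷ 5 K.⋆ K.1# ∷ K.0# ∷ K.- (5 K.⋆ K.1#) ∷ K.0# ∷ K.1# ∷ []
    f≈0 : eval ι f-coeffs x ≈ 0#
    f≈0 = let open ≈R in begin
      eval ι f-coeffs x
        ≈⟨ +-congˡ (*-congˡ (+-cong (ι-⋆1 5) (*-congˡ (+-cong ι-0 (*-congˡ (+-cong (trans
            (ι-neg _) (-‿cong (ι-⋆1 5))) (*-congˡ (+-cong ι-0 (*-congˡ (+-congʳ ι-1)))))))))) ⟩
      _ ≈⟨ solve 2 (λ x c → c :+ x :* ((5 :× :1) :+ x :* (:0 :+ x :* (:- (5 :× :1) :+ x :*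
          (:0 :+ x :* (:1 :+ x :* :0)))))
                  := (x :^ 5 :- (5 :× (x :^ 3)) :+ (5 :× x)) :+ c) refl x (ι c₀) ⟩
      _ ≈⟨ +-congʳ T₅ ⟨
      T 5 + ι c₀   ≈⟨ y²≈ ⟨
      y ^ 2        ≈⟨ *-congʳ y≈0 ⟩
      0# * y ^ 1   ≈⟨ zeroˡ _ ⟩
      0#           ∎
    contra : ¬ All (λ a → ι a ≈ 0#) f-coeffs
    contra (_ ∷ _ ∷ _ ∷ _ ∷ _ ∷ ι1≈0 ∷ []) = 1≉0 (trans (sym ι-1) ι1≈0)

  y⁻¹≈ : ∀ z → y ⁻¹ * z ≈ (y ⁻¹) ^ p * ((T 5 + ι c₀) ^ m * z)
  y⁻¹≈ z = sym (let open ≈R in begin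
    (y ⁻¹) ^ p * ((T 5 + ι c₀) ^ m * z)
      ≈⟨ *-cong (reflexive (≡.cong ((y ⁻¹) ^_) p≡1+2m)) (*-congʳ (^-congˡ m (sym y²≈))) ⟩
    y ⁻¹ * (y ⁻¹) ^ e * ((y ^ 2) ^ m * z)
      ≈⟨ *-congˡ (*-congʳ (trans (^-assocʳ y 2 m) (reflexive (≡.cong (λ k → y ^ (m ℕ.+ k))
          (ℕ.+-identityʳ m))))) ⟩
    y ⁻¹ * (y ⁻¹) ^ e * (y ^ e * z)
      ≈⟨ solve 4 (λ a b c z → a :* b :* (c :* z) := a :* z :* (b :* c))
          refl (y ⁻¹) ((y ⁻¹) ^ e) (y ^ e) z ⟩
    y ⁻¹ * z * ((y ⁻¹) ^ e * y ^ e)   ≈⟨ *-congˡ (^-distrib-* _ _ e) ⟨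
    y ⁻¹ * z * (y ⁻¹ * y) ^ e         ≈⟨ *-congˡ (^-congˡ e (inverseˡ y y≉0)) ⟩
    y ⁻¹ * z * 1# ^ e                 ≈⟨ *-congˡ (1^ e) ⟩
    y ⁻¹ * z * 1#                     ≈⟨ *-identityʳ _ ⟩
    y ⁻¹ * z                          ∎)
    where
    1^ : ∀ n → 1# ^ n ≈ 1#
    1^ zero    = refl
    1^ (suc n) = trans (*-identityˡ _) (1^ n)

  -- For η = (M₀ + M₁ x) / y, additivity of Frobenius gives ηᵖ = (a + b xᵖ) y⁻ᵖ, which accounts for
  -- the part that is not integrated; the exact part stays exact after multiplication by y⁻ᵖ.
  cartierImage : ∀ {a b} z (M₀ M₁ : K.Carrier) → M₀ K.^ p K.≈ a → M₁ K.^ p K.≈ b →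
    Exact ((T 5 + ι c₀) ^ m * z - (ι a + ι b * x ^ p) * x ^ e) →
    IsCartierImage p C ((y ⁻¹ * z) · d x) (ι M₀ · basis p C 0F ⊕ ι M₁ · basis p C 1F)
  cartierImage {a} {b} z M₀ M₁ M₀ᵖ≈a M₁ᵖ≈b exact =
    proj₁ exact′ , η , α≈ , β≈
    where
    η = (ι M₀ + ι M₁ * x) * y ⁻¹
    ψ = (T 5 + ι c₀) ^ m * z - (ι a + ι b * x ^ p) * x ^ e
    exact′ = exact-* (derivative-^p (y ⁻¹)) exact

    ηᵖ≈ : η ^ p ≈ (ι a + ι b * x ^ p) * (y ⁻¹) ^ p
    ηᵖ≈ = let open ≈R in begin
      η ^ p                                              ≈⟨ ^-distrib-* _ _ p ⟩
      (ι M₀ + ι M₁ * x) ^ p * (y ⁻¹) ^ p                 ≈⟨ *-congʳ (frobenius-+ _ _) ⟩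
      (ι M₀ ^ p + (ι M₁ * x) ^ p) * (y ⁻¹) ^ p           ≈⟨ *-congʳ (+-congˡ
          (^-distrib-* _ _ p)) ⟩
      (ι M₀ ^ p + ι M₁ ^ p * x ^ p) * (y ⁻¹) ^ p
        ≈⟨ *-congʳ (+-cong (trans (sym (ι-^ M₀ p)) (ι-cong M₀ᵖ≈a)) (*-congʳ (trans (sym
            (ι-^ M₁ p)) (ι-cong M₁ᵖ≈b)))) ⟩
      (ι a + ι b * x ^ p) * (y ⁻¹) ^ p                   ∎

    y⁻¹z≈ : y ⁻¹ * z ≈ (y ⁻¹) ^ p * ψ + η ^ p * x ^ (p ℕ.∸ 1)
    y⁻¹z≈ = let open ≈R in begin
      y ⁻¹ * z
        ≈⟨ y⁻¹≈ z ⟩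
      (y ⁻¹) ^ p * ((T 5 + ι c₀) ^ m * z)
        ≈⟨ solve 4 (λ g h k w → g :* h := g :* (h :- k :* w) :+ k :* g :* w)
            refl ((y ⁻¹) ^ p) ((T 5 + ι c₀) ^ m * z) (ι a + ι b * x ^ p) (x ^ e) ⟩
      (y ⁻¹) ^ p * ψ + (ι a + ι b * x ^ p) * (y ⁻¹) ^ p * x ^ e
        ≈⟨ +-congˡ (*-cong ηᵖ≈ (reflexive (≡.cong (x ^_) p∸1≡e))) ⟨
      (y ⁻¹) ^ p * ψ + η ^ p * x ^ (p ℕ.∸ 1)  ∎

    α≈ : (y ⁻¹ * z) · d x ≈Ω d (proj₁ exact′) ⊕ (η ^ p * x ^ (p ℕ.∸ 1)) · d x
    α≈ = let open ΩR in begin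
      (y ⁻¹ * z) · d x                                            ≈⟨ ·-cong y⁻¹z≈ ≈-refl ⟩
      ((y ⁻¹) ^ p * ψ + η ^ p * x ^ (p ℕ.∸ 1)) · d x              ≈⟨ ·-distribʳ _ _ _ ⟩
      ((y ⁻¹) ^ p * ψ) · d x ⊕ (η ^ p * x ^ (p ℕ.∸ 1)) · d x      ≈⟨ ⊕-cong
          (proj₂ exact′) ≈-refl ⟨
      d (proj₁ exact′) ⊕ (η ^ p * x ^ (p ℕ.∸ 1)) · d x            ∎

    β≈ : ι M₀ · (y ⁻¹ · d x) ⊕ ι M₁ · ((x * y ⁻¹) · d x) ≈Ω η · d x
    β≈ = let open ΩR in begin
      ι M₀ · (y ⁻¹ · d x) ⊕ ι M₁ · ((x * y ⁻¹) · d x)    ≈⟨ ⊕-cong (·-assoc _ _ _)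
          (·-assoc _ _ _) ⟨
      (ι M₀ * y ⁻¹) · d x ⊕ (ι M₁ * (x * y ⁻¹)) · d x    ≈⟨ ·-distribʳ _ _ _ ⟨
      (ι M₀ * y ⁻¹ + ι M₁ * (x * y ⁻¹)) · d x
        ≈⟨ ·-cong (solve 4 (λ a b x g → a :* g :+ b :* (x :* g) := (a :+ b :* x) :* g)
            refl (ι M₀) (ι M₁) x (y ⁻¹)) ≈-refl ⟩
      η · d x                                            ∎

  cartierImage-≈ : ∀ {α α′ β} → α′ ≈Ω α → IsCartierImage p C α β → IsCartierImage p C α′ β
  cartierImage-≈ α′≈α (φ , η , α≈ , β≈) = φ , η , ≈-trans α′≈α α≈ , β≈

  -- The column of M for W j dx / y; the basis vectors are the cases j = 1, 2.
  record Column (j : ℕ) : Set (c ⊔ ℓ ⊔ c′ ⊔ ℓ′) where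
    field
      M₀ M₁   : K.Carrier
      M₀ᵖ∈    : (M₀ K.^ p) K.∈𝔽ₚ[ t ]
      M₁ᵖ∈    : (M₁ K.^ p) K.∈𝔽ₚ[ t ]
      M₀≈0    : class p ≢ class j → M₀ K.≈ K.0#
      M₁≈0    : class (p ℕ.+ p) ≢ class j → M₁ K.≈ K.0#
      cartier : IsCartierImage p C ((y ⁻¹ * W j) · d x)
                  (ι M₀ · basis p C 0F ⊕ ι M₁ · basis p C 1F)

  column : ∀ j → j ℕ.≤ 2 → Column j
  column j j≤2
    with a , b , a∈ , b∈ , a≈0 , b≈0 , exact ←
      reduction (ℕ.≤-<-trans (ℕ.+-monoʳ-≤ (m ℕ.* 5) j≤2) 5m+2<3p) (f^-span m j)
    -- Perfectness of K supplies the entries as p-th roots of elements of 𝔽ₚ[t]; a root vanishes as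
    -- soon as its p-th power does.
    with M₀ , M₀ᵖ≈a ← perfect a | M₁ , M₁ᵖ≈b ← perfect b
    = record
      { M₀      = M₀
      ; M₁      = M₁
      ; M₀ᵖ∈    = ∈-≈ (K.sym M₀ᵖ≈a) a∈
      ; M₁ᵖ∈    = ∈-≈ (K.sym M₁ᵖ≈b) b∈
      ; M₀≈0    = λ p≢j → K.^-≈0 p (K.trans M₀ᵖ≈a (a≈0 p≢j))
      ; M₁≈0    = λ 2p≢j → K.^-≈0 p (K.trans M₁ᵖ≈b (b≈0 2p≢j))
      ; cartier = cartierImage (W j) M₀ M₁ M₀ᵖ≈a M₁ᵖ≈b exact
      }

-- Uniqueness of the matrix

module Uniqueness {c ℓ c′ ℓ′} {K : Field c ℓ} {t : Field.Carrier K} {p : ℕ}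
    (p-prime : Prime p) (p≢2 : p ≢ 2) {m : ℕ} (p≡1+2m : p ≡ suc (m ℕ.+ m))
    (K-perfectClosure : IsPerfectClosure p K t)
    (C : FunctionField K t c′ ℓ′) where
  private module K = FieldProperties K
  open IsPerfectClosure K-perfectClosure
  open Exactness p-prime characteristic C
  open Existence p-prime {m} p≡1+2m K-perfectClosure C
  open Relation.Binary.Reasoning.Setoid setoid

  2≉0 : ¬ (2 ⋆ 1# ≈ 0#)
  2≉0 = p∤⇒⋆1≉0 λ p∣2 → p≢2 (ℕ.≤-antisym (∣⇒≤ p∣2)
      (ℕ.nonTrivial⇒n>1 p {{prime⇒nonTrivial p-prime}}))

  -- Formal derivatives of polynomials in x

  -- The product rule in Horner form: (a + x g)′ = g + x g′.
  ∂ : List K.Carrier → Carrier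
  ∂ []       = 0#
  ∂ (a ∷ as) = eval ι as x + x * ∂ as

  -- u = g(x) and u′ = g′(x) for some polynomial g over K.
  PolynomialDerivative : Carrier → Carrier → Set _
  PolynomialDerivative u u′ = ∃[ g ] eval ι g x ≈ u × ∂ g ≈ u′

  pd-≈ : ∀ {u u′ v v′} → u ≈ v → u′ ≈ v′ → PolynomialDerivative u u′ → PolynomialDerivative v v′
  pd-≈ u≈v u′≈v′ (g , g≈u , ∂g≈u′) = g , trans g≈u u≈v , trans ∂g≈u′ u′≈v′

  pd-0 : PolynomialDerivative 0# 0#
  pd-0 = [] , refl , refl

  pd-ι : ∀ a → PolynomialDerivative (ι a) 0#
  pd-ι a = a ∷ [] , solve 2 (λ a x → a :+ x :* :0 := a) refl (ι a) x ,
    solve 1 (λ x → :0 :+ x :* :0 := :0) refl x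

  pd-1 : PolynomialDerivative 1# 0#
  pd-1 = pd-≈ ι-1 refl (pd-ι K.1#)

  pd-+ : ∀ {u u′ v v′} → PolynomialDerivative u u′ → PolynomialDerivative v v′ →
    PolynomialDerivative (u + v) (u′ + v′)
  pd-+ (g , g≈u , ∂g≈u′) (h , h≈v , ∂h≈v′) =
    pd-≈ (+-cong g≈u h≈v) (+-cong ∂g≈u′ ∂h≈v′) (g ∔ h , eval-∔ g h , ∂-∔ g h)
    where
    _∔_ : List K.Carrier → List K.Carrier → List K.Carrier
    []      ∔ h       = h
    (a ∷ g) ∔ []      = a ∷ g
    (a ∷ g) ∔ (b ∷ h) = (a K.+ b) ∷ (g ∔ h)

    eval-∔ : ∀ g h → eval ι (g ∔ h) x ≈ eval ι g x + eval ι h x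
    eval-∔ []      h       = sym (+-identityˡ _)
    eval-∔ (a ∷ g) []      = sym (+-identityʳ _)
    eval-∔ (a ∷ g) (b ∷ h) = trans (+-cong (ι-+ a b) (*-congˡ (eval-∔ g h)))
      (solve 5 (λ a b x g h → (a :+ b) :+ x :* (g :+ h) := (a :+ x :* g) :+ (b :+ x :* h))
        refl (ι a) (ι b) x _ _)

    ∂-∔ : ∀ g h → ∂ (g ∔ h) ≈ ∂ g + ∂ h
    ∂-∔ []      h       = sym (+-identityˡ _)
    ∂-∔ (a ∷ g) []      = sym (+-identityʳ _)
    ∂-∔ (a ∷ g) (b ∷ h) = trans (+-cong (eval-∔ g h) (*-congˡ (∂-∔ g h)))
      (solve 5 (λ g h x g′ h′ → (g :+ h) :+ x :* (g′ :+ h′) := (g :+ x :* g′) :+ (h :+ x :* h′))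
        refl (eval ι g x) (eval ι h x) x _ _)

  pd-x* : ∀ {u u′} → PolynomialDerivative u u′ → PolynomialDerivative (x * u) (u + x * u′)
  pd-x* (g , g≈u , ∂g≈u′) = K.0# ∷ g ,
    trans (+-cong ι-0 (*-congˡ g≈u)) (+-identityˡ _) , +-cong g≈u (*-congˡ ∂g≈u′)

  pd-ι* : ∀ a {u u′} → PolynomialDerivative u u′ → PolynomialDerivative (ι a * u) (ι a * u′)
  pd-ι* a (g , g≈u , ∂g≈u′) = pd-≈ (*-congˡ g≈u) (*-congˡ ∂g≈u′) (scale g)
    where
    scale : ∀ g → PolynomialDerivative (ι a * eval ι g x) (ι a * ∂ g)
    scale []      = pd-≈ (sym (zeroʳ _)) (sym (zeroʳ _)) pd-0
    scale (b ∷ g) = pd-≈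
      (trans (+-congʳ (ι-* a b)) (solve 4 (λ a b x g → a :* b :+ x :* (a :* g)
          := a :* (b :+ x :* g)) refl (ι a) (ι b) x _))
      (solve 4 (λ a x g g′ → :0 :+ (a :* g :+ x :* (a :* g′)) := a :* (g :+ x :* g′))
          refl (ι a) x _ _)
      (pd-+ (pd-ι (a K.* b)) (pd-x* (scale g)))

  pd-* : ∀ {u u′ v v′} → PolynomialDerivative u u′ → PolynomialDerivative v v′ →
    PolynomialDerivative (u * v) (u * v′ + u′ * v)
  pd-* {v = v} {v′} (g , g≈u , ∂g≈u′) Pv =
    pd-≈ (*-congʳ g≈u) (+-cong (*-congʳ g≈u) (*-congʳ ∂g≈u′)) (mul g)
    where
    mul : ∀ g → PolynomialDerivative (eval ι g x * v) (eval ι g x * v′ + ∂ g * v)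
    mul []      = pd-≈ (sym (zeroˡ _)) (solve 2 (λ v v′ → :0 := :0 :* v′ :+ :0 :* v)
        refl v v′) pd-0
    mul (a ∷ g) = pd-≈
      (solve 4 (λ a x g v → a :* v :+ x :* (g :* v) := (a :+ x :* g) :* v) refl (ι a) x _ v)
      (solve 6 (λ a x g g′ v v′ → a :* v′ :+ (g :* v :+ x :* (g :* v′ :+ g′ :* v))
                               := (a :+ x :* g) :* v′ :+ (g :+ x :* g′) :* v)
        refl (ι a) x _ _ v v′)
      (pd-+ (pd-ι* a Pv) (pd-x* (mul g)))

  pd-neg : ∀ {u u′} → PolynomialDerivative u u′ → PolynomialDerivative (- u) (- u′)
  pd-neg Pu = pd-≈ (neg _) (neg _) (pd-ι* (K.- K.1#) Pu)
    where
    neg : ∀ u → ι (K.- K.1#) * u ≈ - u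
    neg u = trans (*-congʳ (trans (ι-neg _) (-‿cong ι-1))) (solve 1 (λ u → :- :1 :* u := :- u)
        refl u)

  pd-T : ∀ n → ∃[ u′ ] PolynomialDerivative (T n) u′
  pd-T 0 = 0# , pd-≈ (ι-⋆1 2) refl (pd-ι _)
  pd-T 1 = _ , pd-≈ (*-identityʳ x) refl (pd-x* pd-1)
  pd-T (suc (suc n)) = _ , pd-+ (pd-x* (proj₂ (pd-T (suc n)))) (pd-neg (proj₂ (pd-T n)))

  -- By transcendence of x, a polynomial vanishing at x has only zero coefficients. With additivity
  -- this makes the derivative independent of the chosen coefficient list.
  pd-zero : ∀ {u u′} → PolynomialDerivative u u′ → u ≈ 0# → u′ ≈ 0#
  pd-zero (g , g≈u , ∂g≈u′) u≈0 =
    trans (sym ∂g≈u′) (∂≈0 g (x-transcendental g (trans g≈u u≈0)))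
    where
    eval≈0 : ∀ g → All (λ a → ι a ≈ 0#) g → eval ι g x ≈ 0#
    eval≈0 []      []          = refl
    eval≈0 (a ∷ g) (a≈0 ∷ g≈0) = +≈0 a≈0 (*≈0 x (eval≈0 g g≈0))
    ∂≈0 : ∀ g → All (λ a → ι a ≈ 0#) g → ∂ g ≈ 0#
    ∂≈0 []      []          = refl
    ∂≈0 (a ∷ g) (a≈0 ∷ g≈0) = +≈0 (eval≈0 g g≈0) (*≈0 x (∂≈0 g g≈0))

  -- Derivatives in K[x , y] and in its fraction field

  -- y² = f forces y′ = f′ / (2y); f′ is read off from T 5, from which f differs by the constant c₀.
  f′ y′ : Carrier
  f′ = proj₁ (pd-T 5)
  y′ = (2 ⋆ 1# * y) ⁻¹ * f′

  -- Brings f′ into the form 2 y y′, so that `rd-*` can treat the term b b₁ y² of a product as a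
  -- polynomial in x.
  pd-y² : PolynomialDerivative (y * y) (y * y′ + y * y′)
  pd-y² = pd-≈
    (trans (sym y²≈) (*-congˡ (*-identityʳ y)))
    (begin
      f′ + 0#                            ≈⟨ +-identityʳ f′ ⟩
      f′                                 ≈⟨ *-identityˡ f′ ⟨
      1# * f′                            ≈⟨ *-congʳ (inverseʳ _ (*-≉0 2≉0 y≉0)) ⟨
      2 ⋆ 1# * y * (2 ⋆ 1# * y) ⁻¹ * f′
        ≈⟨ solve 3 (λ y u f → (2 :× :1) :* y :* u :* f := y :* (u :* f) :+ y :* (u :* f))
            refl y ((2 ⋆ 1# * y) ⁻¹) f′ ⟩
      y * y′ + y * y′                    ∎)
    (pd-+ (proj₂ (pd-T 5)) (pd-ι c₀))

  -- v is the derivative of z in K[x , y], computed from a representation of z.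
  data RegularDerivative (z v : Carrier) : Set (c ⊔ c′ ⊔ ℓ′) where
    rd : ∀ {a a′ b b′} → PolynomialDerivative a a′ → PolynomialDerivative b b′ →
      z ≈ a + b * y → v ≈ a′ + (b′ * y + b * y′) → RegularDerivative z v

  rd-≈ : ∀ {z z₁ v v₁} → z₁ ≈ z → v₁ ≈ v → RegularDerivative z v → RegularDerivative z₁ v₁
  rd-≈ z₁≈z v₁≈v (rd Pa Pb z≈ v≈) = rd Pa Pb (trans z₁≈z z≈) (trans v₁≈v v≈)

  rd-polynomial : ∀ {u u′} → PolynomialDerivative u u′ → RegularDerivative u u′
  rd-polynomial {u} {u′} Pu = rd Pu pd-0
    (solve 2 (λ u y → u := u :+ :0 :* y) refl u y)
    (solve 3 (λ u y y′ → u := u :+ (:0 :* y :+ :0 :* y′)) refl u′ y y′)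

  rd-+ : ∀ {z v z₁ v₁} → RegularDerivative z v → RegularDerivative z₁ v₁ →
      RegularDerivative (z + z₁) (v + v₁)
  rd-+ (rd Pa Pb z≈ v≈) (rd Pa₁ Pb₁ z₁≈ v₁≈) = rd (pd-+ Pa Pa₁) (pd-+ Pb Pb₁)
    (trans (+-cong z≈ z₁≈)
      (solve 5 (λ a b a₁ b₁ y → (a :+ b :* y) :+ (a₁ :+ b₁ :* y) := (a :+ a₁) :+ (b :+ b₁) :* y)
          refl _ _ _ _ y))
    (trans (+-cong v≈ v₁≈)
      (solve 8 (λ a b b′ a₁ b₁ b₁′ y y′ → (a :+ (b′ :* y :+ b :* y′)) :+ (a₁ :+
          (b₁′ :* y :+ b₁ :* y′))
          := (a :+ a₁) :+ ((b′ :+ b₁′) :* y :+ (b :+ b₁) :* y′)) refl _ _ _ _ _ _ y y′))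

  rd-neg : ∀ {z v} → RegularDerivative z v → RegularDerivative (- z) (- v)
  rd-neg (rd Pa Pb z≈ v≈) = rd (pd-neg Pa) (pd-neg Pb)
    (trans (-‿cong z≈) (solve 3 (λ a b y → :- (a :+ b :* y) := :- a :+ :- b :* y) refl _ _ y))
    (trans (-‿cong v≈) (solve 5 (λ a b b′ y y′ → :- (a :+ (b′ :* y :+ b :* y′))
        := :- a :+ (:- b′ :* y :+ :- b :* y′)) refl _ _ _ y y′))

  rd-* : ∀ {z v z₁ v₁} → RegularDerivative z v → RegularDerivative z₁ v₁ →
    RegularDerivative (z * z₁) (z * v₁ + v * z₁)
  rd-* (rd {a} {a′} {b} {b′} Pa Pb z≈ v≈) (rd {a₁} {a₁′} {b₁} {b₁′} Pa₁ Pb₁ z₁≈ v₁≈) = rd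
    (pd-+ (pd-* Pa Pa₁) (pd-* (pd-* Pb Pb₁) pd-y²))
    (pd-+ (pd-* Pa Pb₁) (pd-* Pb Pa₁))
    (trans (*-cong z≈ z₁≈)
      (solve 5 (λ a b a₁ b₁ y → (a :+ b :* y) :* (a₁ :+ b₁ :* y)
          := (a :* a₁ :+ b :* b₁ :* (y :* y)) :+ (a :* b₁ :+ b :* a₁) :* y)
        refl a b a₁ b₁ y))
    (trans (+-cong (*-cong z≈ v₁≈) (*-cong v≈ z₁≈))
      (solve 10 (λ a a′ b b′ a₁ a₁′ b₁ b₁′ y y′ →
          (a :+ b :* y) :* (a₁′ :+ (b₁′ :* y :+ b₁ :* y′)) :+ (a′ :+ (b′ :* y :+ b :* y′)) :*
              (a₁ :+ b₁ :* y)
          := ((a :* a₁′ :+ a′ :* a₁) :+ (b :* b₁ :* (y :* y′ :+ y :* y′) :+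
              (b :* b₁′ :+ b′ :* b₁) :* (y :* y)))
             :+ (((a :* b₁′ :+ a′ :* b₁) :+ (b :* a₁′ :+ b′ :* a₁)) :* y :+
                 (a :* b₁ :+ b :* a₁) :* y′))
        refl a a′ b b′ a₁ a₁′ b₁ b₁′ y y′))

  -- If a + b y = 0 then a² − b² y² is a polynomial in x that vanishes, and
  -- hence so does its derivative, which is −2 b y times the derivative of a + b y.
  rd-zero : ∀ {z v} → RegularDerivative z v → z ≈ 0# → v ≈ 0#
  rd-zero {z} {v} (rd {a} {a′} {b} {b′} Pa Pb z≈ v≈) z≈0 with b ≟ 0#
  ... | yes b≈0 = trans v≈ (+≈0 (pd-zero Pa a≈0)
      (+≈0 (trans (*-congʳ (pd-zero Pb b≈0)) (zeroˡ y)) (trans (*-congʳ b≈0) (zeroˡ y′))))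
    where
    a≈0 : a ≈ 0#
    a≈0 = begin
      a               ≈⟨ solve 3 (λ a b y → a := (a :+ b :* y) :- b :* y) refl a b y ⟩
      (a + b * y) - b * y  ≈⟨ +≈0 (trans (sym z≈) z≈0) (neg≈0 (trans (*-congʳ b≈0) (zeroˡ y))) ⟩
      0#              ∎
  ... | no b≉0 = trans v≈ (*-cancelˡ-0 2by≉0 (begin
      2 ⋆ 1# * (b * y) * (a′ + (b′ * y + b * y′))
        ≈⟨ solve 6 (λ a a′ b b′ y y′ → (2 :× :1) :* (b :* y) :* (a′ :+ (b′ :* y :+ b :* y′))
             := (2 :× :1) :* a′ :* (a :+ b :* y) :- ((a :* a′ :+ a′ :* a) :+ :- (b :* b :*
                 (y :* y′ :+ y :* y′) :+ (b :* b′ :+ b′ :* b) :* (y :* y))))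
             refl a a′ b b′ y y′ ⟩
      2 ⋆ 1# * a′ * (a + b * y) - norm′
        ≈⟨ +≈0 (*≈0 _ a+by≈0) (neg≈0 (pd-zero (pd-+ (pd-* Pa Pa) (pd-neg (pd-*
            (pd-* Pb Pb) pd-y²))) norm≈0)) ⟩
      0#  ∎))
    where
    a+by≈0 = trans (sym z≈) z≈0
    norm′ = (a * a′ + a′ * a) + - (b * b * (y * y′ + y * y′) + (b * b′ + b′ * b) * (y * y))
    2by≉0 = *-≉0 2≉0 (*-≉0 b≉0 y≉0)
    norm≈0 : a * a + - (b * b * (y * y)) ≈ 0#
    norm≈0 = trans (solve 3 (λ a b y → a :* a :+ :- (b :* b :* (y :* y))
        := (a :- b :* y) :* (a :+ b :* y)) refl a b y)
      (*≈0 _ a+by≈0)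

  -- v is the derivative of z: it satisfies the Leibniz rule for the product of
  -- z with a denominator of z.
  data Derivative (z v : Carrier) : Set (c ⊔ c′ ⊔ ℓ′) where
    der : ∀ {h h′} → RegularDerivative h h′ → ¬ (h ≈ 0#) →
      RegularDerivative (h * z) (h * v + h′ * z) → Derivative z v

  der-≈ : ∀ {z z₁ v} → z ≈ z₁ → Derivative z v → Derivative z₁ v
  der-≈ z≈z₁ (der Rh h≉0 Rhz) = der Rh h≉0
    (rd-≈ (*-congˡ (sym z≈z₁)) (+-congˡ (*-congˡ (sym z≈z₁))) Rhz)

  -- For two denominators h and k of z, k (h z) - h (k z) = 0, and the derivative of the left side
  -- is h k (v - v₁).
  der-unique : ∀ {z v v₁} → Derivative z v → Derivative z v₁ → v ≈ v₁
  der-unique {z} {v} {v₁} (der {h} {h′} Rh h≉0 Rhz) (der {k} {k′} Rk k≉0 Rkz) =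
    -≈0⇒≈ (*-cancelˡ-0 (*-≉0 h≉0 k≉0) (begin
      h * k * (v - v₁)
        ≈⟨ solve 7 (λ h h′ k k′ z v v₁ → h :* k :* (v :- v₁)
             := (k :* (h :* v :+ h′ :* z) :+ k′ :* (h :* z)) :+ :- (h :*
                 (k :* v₁ :+ k′ :* z) :+ h′ :* (k :* z)))
             refl h h′ k k′ z v v₁ ⟩
      (k * (h * v + h′ * z) + k′ * (h * z)) + - (h * (k * v₁ + k′ * z) + h′ * (k * z))
        ≈⟨ rd-zero (rd-+ (rd-* Rk Rhz) (rd-neg (rd-* Rh Rkz)))
             (solve 3 (λ h k z → k :* (h :* z) :+ :- (h :* (k :* z)) := :0) refl h k z) ⟩
      0#  ∎))

  der-regular : ∀ {z v} → RegularDerivative z v → Derivative z v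
  der-regular {z} {v} Rz = der (rd-polynomial pd-1) 1≉0
    (rd-≈ (*-identityˡ z) (solve 2 (λ z v → :1 :* v :+ :0 :* z := v) refl z v) Rz)

  der-+ : ∀ {z v z₁ v₁} → Derivative z v → Derivative z₁ v₁ → Derivative (z + z₁) (v + v₁)
  der-+ {z} {v} {z₁} {v₁} (der {h} {h′} Rh h≉0 Rhz) (der {k} {k′} Rk k≉0 Rkz₁) =
    der (rd-* Rh Rk) (*-≉0 h≉0 k≉0) (rd-≈
      (solve 4 (λ h k z z₁ → h :* k :* (z :+ z₁) := k :* (h :* z) :+ h :* (k :* z₁))
          refl h k z z₁)
      (solve 8 (λ h h′ k k′ z v z₁ v₁ → h :* k :* (v :+ v₁) :+ (h :* k′ :+ h′ :* k) :* (z :+ z₁)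
          := (k :* (h :* v :+ h′ :* z) :+ k′ :* (h :* z)) :+ (h :*
              (k :* v₁ :+ k′ :* z₁) :+ h′ :* (k :* z₁)))
        refl h h′ k k′ z v z₁ v₁)
      (rd-+ (rd-* Rk Rhz) (rd-* Rh Rkz₁)))

  der-* : ∀ {z v z₁ v₁} → Derivative z v → Derivative z₁ v₁ →
      Derivative (z * z₁) (z * v₁ + z₁ * v)
  der-* {z} {v} {z₁} {v₁} (der {h} {h′} Rh h≉0 Rhz) (der {k} {k′} Rk k≉0 Rkz₁) =
    der (rd-* Rh Rk) (*-≉0 h≉0 k≉0) (rd-≈
      (solve 4 (λ h k z z₁ → h :* k :* (z :* z₁) := h :* z :* (k :* z₁)) refl h k z z₁)
      (solve 8 (λ h h′ k k′ z v z₁ v₁ → h :* k :* (z :* v₁ :+ z₁ :* v) :+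
          (h :* k′ :+ h′ :* k) :* (z :* z₁)
          := h :* z :* (k :* v₁ :+ k′ :* z₁) :+ (h :* v :+ h′ :* z) :* (k :* z₁))
        refl h h′ k k′ z v z₁ v₁)
      (rd-* Rhz Rkz₁))

  derivative : ∀ z → ∃[ v ] Derivative z v
  derivative z with generated z
  ... | a , b , h , h≉0 , hz≈ = v , der (rd-polynomial (h , refl , refl)) h≉0
      (rd (a , refl , refl) (b , refl , refl) hz≈ (begin
        eval ι h x * v + ∂ h * z
          ≈⟨ +-congʳ (trans (sym (*-assoc _ _ _)) (trans (*-congʳ (inverseʳ _ h≉0))
              (*-identityˡ _))) ⟩
        (w - ∂ h * z) + ∂ h * z  ≈⟨ solve 2 (λ w u → w :- u :+ u := w) refl w (∂ h * z) ⟩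
        w                        ∎))
    where
    -- `w` is the derivative of h z = a + b y, and `v` solves h v + h′ z = w.
    w = ∂ a + (∂ b * y + eval ι b x * y′)
    v = eval ι h x ⁻¹ * (w - ∂ h * z)

  -- The derivation D and the map it induces on differentials

  -- The value is computed from the representation that `generated` happens to return; `der-unique`
  -- makes the choice irrelevant and yields the rules up to `D-x`.
  D : Carrier → Carrier
  D z = proj₁ (derivative z)

  D-der : ∀ z → Derivative z (D z)
  D-der z = proj₂ (derivative z)

  D-cong : ∀ {a b} → a ≈ b → D a ≈ D b
  D-cong {a} {b} a≈b = der-unique (der-≈ a≈b (D-der a)) (D-der b)

  D-+ : ∀ a b → D (a + b) ≈ D a + D b
  D-+ a b = der-unique (D-der (a + b)) (der-+ (D-der a) (D-der b))

  D-* : ∀ a b → D (a * b) ≈ a * D b + b * D a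
  D-* a b = der-unique (D-der (a * b)) (der-* (D-der a) (D-der b))

  D-ι : ∀ k → D (ι k) ≈ 0#
  D-ι k = der-unique (D-der (ι k)) (der-regular (rd-polynomial (pd-ι k)))

  D-x : D x ≈ 1#
  D-x = der-unique (D-der x) (der-regular (rd-polynomial
    (pd-≈ (*-identityʳ x) (trans (+-congˡ (zeroʳ x)) (+-identityʳ 1#)) (pd-x* pd-1))))

  -- The F-linear map Ω → F sending da to D a, hence dx to 1. That it respects every relation of Ω
  -- shows that Ω does not collapse.
  coefficient : Ω → Carrier
  coefficient 0Ω      = 0#
  coefficient (α ⊕ β) = coefficient α + coefficient β
  coefficient (a · α) = a * coefficient α
  coefficient (d a)   = D a

  coefficient-cong : ∀ {α β} → α ≈Ω β → coefficient α ≈ coefficient β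
  coefficient-cong ≈-refl = refl
  coefficient-cong (≈-sym p) = sym (coefficient-cong p)
  coefficient-cong (≈-trans p q) = trans (coefficient-cong p) (coefficient-cong q)
  coefficient-cong (⊕-cong p q) = +-cong (coefficient-cong p) (coefficient-cong q)
  coefficient-cong (·-cong a≈b p) = *-cong a≈b (coefficient-cong p)
  coefficient-cong (d-cong a≈b) = D-cong a≈b
  coefficient-cong (⊕-assoc α β γ) = +-assoc _ _ _
  coefficient-cong (⊕-comm α β) = +-comm _ _
  coefficient-cong (⊕-identityʳ α) = +-identityʳ _
  coefficient-cong (·-distribˡ a α β) = distribˡ _ _ _
  coefficient-cong (·-distribʳ a b α) = distribʳ _ _ _
  coefficient-cong (·-assoc a b α) = *-assoc _ _ _
  coefficient-cong (·-identity α) = *-identityˡ _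
  coefficient-cong (·-zero α) = zeroˡ _
  coefficient-cong (d-+ a b) = D-+ a b
  coefficient-cong (d-* a b) = D-* a b
  coefficient-cong (d-constant k) = D-ι k

  coefficient-dx : ∀ a → coefficient (a · d x) ≈ a
  coefficient-dx a = trans (*-congˡ D-x) (*-identityʳ a)

  D-^p : ∀ g → D (g ^ p) ≈ 0#
  D-^p g = trans (coefficient-cong (derivative-^p g)) (zeroˡ _)

  D-constant* : ∀ {g} → D g ≈ 0# → ∀ z → D (g * z) ≈ g * D z
  D-constant* {g} Dg≈0 z = trans (D-* g z) (trans (+-congˡ (*≈0 z Dg≈0)) (+-identityʳ _))

  D-⋆1 : ∀ n → D (n ⋆ 1#) ≈ 0#
  D-⋆1 n = trans (D-cong (sym (ι-⋆1 n))) (D-ι _)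

  D-0 : D 0# ≈ 0#
  D-0 = D-⋆1 0

  -- Iterates of D

  D^ : ℕ → Carrier → Carrier
  D^ zero    z = z
  D^ (suc n) z = D (D^ n z)

  D^-cong : ∀ n {a b} → a ≈ b → D^ n a ≈ D^ n b
  D^-cong zero    a≈b = a≈b
  D^-cong (suc n) a≈b = D-cong (D^-cong n a≈b)

  D^-+ : ∀ n a b → D^ n (a + b) ≈ D^ n a + D^ n b
  D^-+ zero    a b = refl
  D^-+ (suc n) a b = trans (D-cong (D^-+ n a b)) (D-+ _ _)

  D^-constant* : ∀ n {g} → D g ≈ 0# → ∀ z → D^ n (g * z) ≈ g * D^ n z
  D^-constant* zero    Dg≈0 z = refl
  D^-constant* (suc n) Dg≈0 z = trans (D-cong (D^-constant* n Dg≈0 z)) (D-constant* Dg≈0 _)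

  D^-suc : ∀ n z → D^ n (D z) ≈ D^ (suc n) z
  D^-suc zero    z = refl
  D^-suc (suc n) z = D-cong (D^-suc n z)

  D^-constant : ∀ n {g} → D g ≈ 0# → D^ (suc n) g ≈ 0#
  D^-constant zero    Dg≈0 = Dg≈0
  D^-constant (suc n) Dg≈0 = trans (D-cong (D^-constant n Dg≈0)) D-0

  D^-x* : ∀ n z → D^ (suc n) (x * z) ≈ x * D^ (suc n) z + suc n ⋆ 1# * D^ n z
  D^-x* zero z = trans (D-* x z) (+-congˡ (trans (*-congˡ D-x)
    (solve 1 (λ z → z :* :1 := (:1 :+ :0) :* z) refl z)))
  D^-x* (suc n) z = begin
    D (D^ (suc n) (x * z))                                    ≈⟨ D-cong (D^-x* n z) ⟩
    D (x * D^ (suc n) z + suc n ⋆ 1# * D^ n z)                ≈⟨ D-+ _ _ ⟩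
    D (x * D^ (suc n) z) + D (suc n ⋆ 1# * D^ n z)
      ≈⟨ +-cong (trans (D-* x _) (+-congˡ (*-congˡ D-x))) (D-constant* (D-⋆1 (suc n)) _) ⟩
    (x * D^ (suc (suc n)) z + D^ (suc n) z * 1#) + suc n ⋆ 1# * D^ (suc n) z
      ≈⟨ solve 3 (λ u w k → (u :+ w :* :1) :+ k :* w := u :+ (:1 :+ k) :* w)
          refl _ (D^ (suc n) z) (suc n ⋆ 1#) ⟩
    x * D^ (suc (suc n)) z + suc (suc n) ⋆ 1# * D^ (suc n) z  ∎

  D^-x^ : ∀ n → D^ n (x ^ n) ≈ (n !) ⋆ 1#
  D^-x^ zero    = sym (+-identityʳ 1#)
  D^-x^ (suc n) = begin
    D^ (suc n) (x * x ^ n)                          ≈⟨ D^-x* n (x ^ n) ⟩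
    x * D (D^ n (x ^ n)) + suc n ⋆ 1# * D^ n (x ^ n)
      ≈⟨ +-cong (*≈0 x (trans (D-cong (D^-x^ n)) (D-⋆1 (n !)))) (*-congˡ (D^-x^ n)) ⟩
    0# + suc n ⋆ 1# * (n !) ⋆ 1#                    ≈⟨ +-identityˡ _ ⟩
    suc n ⋆ 1# * (n !) ⋆ 1#                         ≈⟨ ×1-homo-* (suc n) (n !) ⟨
    (suc n !) ⋆ 1#                                  ∎

  -- In Dᵖ (x g) = x Dᵖ g + p Dᵖ⁻¹ g the second term vanishes, and the first does by induction.
  Dᵖ-polynomial : ∀ g → D^ (suc e) (eval ι g x) ≈ 0#
  Dᵖ-polynomial []      = D^-constant e D-0
  Dᵖ-polynomial (a ∷ g) = trans (D^-+ (suc e) _ _) (+≈0 (D^-constant e (D-ι a)) (begin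
    D^ (suc e) (x * eval ι g x)   ≈⟨ D^-x* e _ ⟩
    x * D^ (suc e) (eval ι g x) + suc e ⋆ 1# * D^ e (eval ι g x)
      ≈⟨ +≈0 (*≈0 x (Dᵖ-polynomial g)) (trans (*-congʳ 1+e⋆1≈0) (zeroˡ _)) ⟩
    0#                            ∎))
    where
    1+e⋆1≈0 : suc e ⋆ 1# ≈ 0#
    1+e⋆1≈0 = trans (×-congˡ 1+e≡p) p⋆1≈0′

  pd-^ : ∀ {u u′} n → PolynomialDerivative u u′ → ∃[ v ] PolynomialDerivative (u ^ n) v
  pd-^ zero    Pu = _ , pd-1
  pd-^ (suc n) Pu = _ , pd-* Pu (proj₂ (pd-^ n Pu))

  Dᵖ-pd : ∀ {u u′} → PolynomialDerivative u u′ → D^ (suc e) u ≈ 0#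
  Dᵖ-pd (g , g≈u , _) = trans (D^-cong (suc e) (sym g≈u)) (Dᵖ-polynomial g)

  -- Since y = yᵖ / f(x)ᵐ, every element of F has the form (a + b yᵖ) / gᵖ with
  -- a, b and g in K[x].
  Dᵖ≈0 : ∀ z → D^ (suc e) z ≈ 0#
  Dᵖ≈0 z with generated z
  ... | as , bs , hs , h≉0 , hz≈ = *-cancelˡ-0 (^-≉0 p g≉0) (begin
      g ^ p * D^ (suc e) z                        ≈⟨ D^-constant* (suc e) (D-^p g) z ⟨
      D^ (suc e) (g ^ p * z)                      ≈⟨ D^-cong (suc e) gᵖz≈ ⟩
      D^ (suc e) (g ^ e * (fᵐ * a) + y ^ p * (g ^ e * b))
        ≈⟨ D^-+ (suc e) _ _ ⟩
      D^ (suc e) (g ^ e * (fᵐ * a)) + D^ (suc e) (y ^ p * (g ^ e * b))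
        ≈⟨ +≈0 (Dᵖ-pd (pd-* Pgᵉ (pd-* Pfᵐ (as , refl , refl))))
             (trans (D^-constant* (suc e) (D-^p y) _) (*≈0 _ (Dᵖ-pd (pd-* Pgᵉ (bs ,
                 refl , refl))))) ⟩
      0#                                          ∎)
    where
    a = eval ι as x
    b = eval ι bs x
    h = eval ι hs x
    fᵐ = (y * y) ^ m
    -- The extra factor fᵐ in the denominator turns b y into b yᵖ.
    g = fᵐ * h
    Pfᵐ = proj₂ (pd-^ m pd-y²)
    Pgᵉ = proj₂ (pd-^ e (pd-* Pfᵐ (hs , refl , refl)))
    g≉0 = *-≉0 (^-≉0 m (*-≉0 y≉0 y≉0)) h≉0

    yᵖ≈ : y ^ p ≈ fᵐ * y
    yᵖ≈ = begin
      y ^ p              ≡⟨ ≡.cong (y ^_) p≡1+2m ⟩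
      y * y ^ (m ℕ.+ m)  ≈⟨ *-congˡ (trans (^-homo-* y m m) (sym (^-distrib-* y y m))) ⟩
      y * fᵐ             ≈⟨ *-comm _ _ ⟩
      fᵐ * y             ∎

    gᵖz≈ : g ^ p * z ≈ g ^ e * (fᵐ * a) + y ^ p * (g ^ e * b)
    gᵖz≈ = begin
      g ^ p * z              ≡⟨ ≡.cong (λ n → g ^ n * z) p≡1+2m ⟩
      fᵐ * h * g ^ e * z
        ≈⟨ solve 4 (λ f h u z → f :* h :* u :* z := u :* f :* (h :* z)) refl fᵐ h (g ^ e) z ⟩
      g ^ e * fᵐ * (h * z)      ≈⟨ *-congˡ hz≈ ⟩
      g ^ e * fᵐ * (a + b * y)
        ≈⟨ solve 5 (λ u f a b y → u :* f :* (a :+ b :* y)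
            := u :* (f :* a) :+ f :* y :* (u :* b)) refl (g ^ e) fᵐ a b y ⟩
      g ^ e * (fᵐ * a) + fᵐ * y * (g ^ e * b)    ≈⟨ +-congˡ (*-congʳ yᵖ≈) ⟨
      g ^ e * (fᵐ * a) + y ^ p * (g ^ e * b)     ∎

  -- Uniqueness of Cartier images and of coordinates

  D^-cartier : ∀ {α φ η} → α ≈Ω d φ ⊕ (η ^ p * x ^ (p ℕ.∸ 1)) · d x →
    D^ e (coefficient α) ≈ η ^ p * (e !) ⋆ 1#
  D^-cartier {α} {φ} {η} α≈ = begin
    D^ e (coefficient α)
      ≈⟨ D^-cong e (trans (coefficient-cong α≈) (+-congˡ (coefficient-dx _))) ⟩
    D^ e (D φ + η ^ p * x ^ (p ℕ.∸ 1))       ≡⟨ ≡.cong (λ n → D^ e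
        (D φ + η ^ p * x ^ n)) p∸1≡e ⟩
    D^ e (D φ + η ^ p * x ^ e)               ≈⟨ D^-+ e _ _ ⟩
    D^ e (D φ) + D^ e (η ^ p * x ^ e)
      ≈⟨ +-cong (trans (D^-suc e φ) (Dᵖ≈0 φ)) (D^-constant* e (D-^p η) _) ⟩
    0# + η ^ p * D^ e (x ^ e)                ≈⟨ +-identityˡ _ ⟩
    η ^ p * D^ e (x ^ e)                     ≈⟨ *-congˡ (D^-x^ e) ⟩
    η ^ p * (e !) ⋆ 1#                       ∎

  -- Cancelling (p - 1)! recovers ηᵖ, and injectivity of Frobenius recovers η. Coefficients are all
  -- that the comparison of coordinates requires.
  cartierImage-unique : ∀ {α β β₁} → IsCartierImage p C α β → IsCartierImage p C α β₁ →
    coefficient β ≈ coefficient β₁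
  cartierImage-unique {α} {β} {β₁} (φ , η , α≈ , β≈) (φ₁ , η₁ , α≈₁ , β₁≈) = begin
    coefficient β            ≈⟨ coefficient-cong β≈ ⟩
    coefficient (η · d x)    ≈⟨ *-congʳ (frobenius-injective (*-cancelˡ e!⋆1≉0 (begin
      (e !) ⋆ 1# * η ^ p        ≈⟨ *-comm _ _ ⟩
      η ^ p * (e !) ⋆ 1#        ≈⟨ D^-cartier α≈ ⟨
      D^ e (coefficient α)      ≈⟨ D^-cartier α≈₁ ⟩
      η₁ ^ p * (e !) ⋆ 1#       ≈⟨ *-comm _ _ ⟩
      (e !) ⋆ 1# * η₁ ^ p       ∎))) ⟩
    coefficient (η₁ · d x)   ≈⟨ coefficient-cong β₁≈ ⟨
    coefficient β₁           ∎
    where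
    e!⋆1≉0 : ¬ ((e !) ⋆ 1# ≈ 0#)
    e!⋆1≉0 = p∤⇒⋆1≉0 (prime∤! p-prime (≡.subst (e ℕ.<_) 1+e≡p (ℕ.n<1+n e)))

  -- Divided by y⁻¹ D x, the two sides are N₀ + N₁ x and M₀ + M₁ x; as x is transcendental, 1 and x
  -- are independent over K.
  coordinates-unique : ∀ {N₀ N₁ M₀ M₁} →
    coefficient (ι N₀ · basis p C 0F ⊕ ι N₁ · basis p C 1F) ≈
    coefficient (ι M₀ · basis p C 0F ⊕ ι M₁ · basis p C 1F) →
    N₀ K.≈ M₀ × N₁ K.≈ M₁
  coordinates-unique {N₀} {N₁} {M₀} {M₁} eq = conclude (x-transcendental _ difference≈0)
    where
    y⁻¹≉0 : ¬ (y ⁻¹ ≈ 0#)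
    y⁻¹≉0 y⁻¹≈0 = 1≉0 (trans (sym (inverseʳ y y≉0)) (*≈0 y y⁻¹≈0))

    difference≈0 : eval ι ((N₀ K.- M₀) ∷ (N₁ K.- M₁) ∷ []) x ≈ 0#
    difference≈0 = *-cancelˡ-0 (*-≉0 y⁻¹≉0 (λ Dx≈0 → 1≉0 (trans (sym D-x) Dx≈0))) (begin
      y ⁻¹ * D x * (ι (N₀ K.- M₀) + x * (ι (N₁ K.- M₁) + x * 0#))
        ≈⟨ *-congˡ (+-cong (ι-- N₀ M₀) (*-congˡ (+-congʳ (ι-- N₁ M₁)))) ⟩
      y ⁻¹ * D x * ((ι N₀ - ι M₀) + x * ((ι N₁ - ι M₁) + x * 0#))
        ≈⟨ solve 7 (λ u v x n₀ n₁ m₀ m₁ → u :* v :* ((n₀ :- m₀) :+ x :* ((n₁ :- m₁) :+ x :* :0))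
             := (n₀ :* (u :* v) :+ n₁ :* (x :* u :* v)) :- (m₀ :* (u :* v) :+ m₁ :*
                 (x :* u :* v)))
             refl (y ⁻¹) (D x) x (ι N₀) (ι N₁) (ι M₀) (ι M₁) ⟩
      _  ≈⟨ ≈⇒-≈0 eq ⟩
      0#  ∎)
      where
      ι-- : ∀ a b → ι (a K.- b) ≈ ι a - ι b
      ι-- a b = trans (ι-+ _ _) (+-congˡ (ι-neg b))

    conclude : All (λ a → ι a ≈ 0#) ((N₀ K.- M₀) ∷ (N₁ K.- M₁) ∷ []) → N₀ K.≈ M₀ × N₁ K.≈ M₁
    conclude (N₀≈M₀ ∷ N₁≈M₁ ∷ []) =
      K.-≈0⇒≈ (ι-injective-0 N₀≈M₀) , K.-≈0⇒≈ (ι-injective-0 N₁≈M₁)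

-- The matrix and its shape according to p mod 5

class-±1 : ∀ n → n % 5 ≡ 1 ⊎ n % 5 ≡ 4 → class n ≡ 1
class-±1 n (inj₁ n%5≡1) = ≡.trans (class-% n) (≡.cong class n%5≡1)
class-±1 n (inj₂ n%5≡4) = ≡.trans (class-% n) (≡.cong class n%5≡4)

class-±2 : ∀ n → n % 5 ≡ 2 ⊎ n % 5 ≡ 3 → class n ≡ 2
class-±2 n (inj₁ n%5≡2) = ≡.trans (class-% n) (≡.cong class n%5≡2)
class-±2 n (inj₂ n%5≡3) = ≡.trans (class-% n) (≡.cong class n%5≡3)

module CartierManin {c ℓ c′ ℓ′} {K : Field c ℓ} {t : Field.Carrier K} {p : ℕ}
    (p-prime : Prime p) (p≢2 : p ≢ 2) {m : ℕ} (p≡1+2m : p ≡ suc (m ℕ.+ m))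
    (K-perfectClosure : IsPerfectClosure p K t)
    (C : FunctionField K t c′ ℓ′) where
  private module K = FieldProperties K
  open IsPerfectClosure K-perfectClosure
  open Exactness p-prime characteristic C
  open Existence p-prime {m} p≡1+2m K-perfectClosure C
  open Uniqueness p-prime p≢2 {m} p≡1+2m K-perfectClosure C

  column₁ = column 1 (s≤s z≤n)
  column₂ = column 2 (s≤s (s≤s z≤n))
  module Column₁ = Column column₁
  module Column₂ = Column column₂

  M : Fin 2 → Fin 2 → K.Carrier
  M 0F 0F = Column₁.M₀
  M 0F 1F = Column₂.M₀
  M 1F 0F = Column₁.M₁
  M 1F 1F = Column₂.M₁

  M-cartierManin : IsCartierManinMatrix p C M
  M-cartierManin 0F = cartierImage-≈
    (·-cong (sym (*-identityʳ _)) ≈-refl) Column₁.cartier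
  M-cartierManin 1F = cartierImage-≈
    (·-cong (solve 2 (λ x g → x :* g := g :* (x :* :1 :- :0)) refl x (y ⁻¹)) ≈-refl)
    Column₂.cartier

  M-unique : ∀ N → IsCartierManinMatrix p C N → ∀ i j → N i j K.≈ M i j
  M-unique N N-cartierManin = λ { 0F j → proj₁ (column≈ j) ; 1F j → proj₂ (column≈ j) }
    where
    column≈ : ∀ j → N 0F j K.≈ M 0F j × N 1F j K.≈ M 1F j
    column≈ j = coordinates-unique (cartierImage-unique (N-cartierManin j) (M-cartierManin j))

  class-2p : ∀ {r} → class p ≡ r → class (p ℕ.+ p) ≡ class (r ℕ.+ r)
  class-2p p≡r = ≡.trans (class-double p) (≡.cong (λ r → class (r ℕ.+ r)) p≡r)

  distinct : ∀ {n r s : ℕ} → r ≢ s → n ≡ r → n ≢ s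
  distinct r≢s n≡r n≡s = r≢s (≡.trans (≡.sym n≡r) n≡s)

  -- W p can occur only in the column j = 1, and W (2p), whose index has class 2, only in the column
  -- j = 2.
  M-diagonal : class p ≡ 1 → IsDiagonal K M
  M-diagonal p≡1 = Column₂.M₀≈0 (distinct (λ ()) p≡1) ,
                   Column₁.M₁≈0 (distinct (λ ()) (class-2p p≡1))

  -- The two columns exchange roles, since 2p ≡ ±4 ≡ ∓1 has class 1.
  M-antidiagonal : class p ≡ 2 → IsAntidiagonal K M
  M-antidiagonal p≡2 = Column₁.M₀≈0 (distinct (λ ()) p≡2) ,
                       Column₂.M₁≈0 (distinct (λ ()) (class-2p p≡2))

  Mᵖ∈𝔽ₚ[t] : ∀ i j → entrywisePower K p M i j K.∈𝔽ₚ[ t ]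
  Mᵖ∈𝔽ₚ[t] 0F 0F = Column₁.M₀ᵖ∈
  Mᵖ∈𝔽ₚ[t] 0F 1F = Column₂.M₀ᵖ∈
  Mᵖ∈𝔽ₚ[t] 1F 0F = Column₁.M₁ᵖ∈
  Mᵖ∈𝔽ₚ[t] 1F 1F = Column₂.M₁ᵖ∈

theorem4p1 : ∀ {c ℓ c′ ℓ′} (p : ℕ) → Prime p → p ≢ 2 → p ≢ 5 →
    (K : Field c ℓ) (t : Field.Carrier K) → IsPerfectClosure p K t →
    (C : FunctionField K t c′ ℓ′) →
    Σ[ M ∈ (Fin 2 → Fin 2 → Field.Carrier K) ]
    ( IsCartierManinMatrix p C M
    × (∀ N → IsCartierManinMatrix p C N → ∀ i j → Field._≈_ K (N i j) (M i j))
    × ((p % 5 ≡ 1 ⊎ p % 5 ≡ 4) → IsDiagonal K M)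
    × ((p % 5 ≡ 2 ⊎ p % 5 ≡ 3) → IsAntidiagonal K M)
    × (∀ i j → Field._∈𝔽ₚ[_] K (entrywisePower K p M i j) t) )
theorem4p1 p p-prime p≢2 _ K t K-perfectClosure C
  with m , p≡1+2m ← odd-prime p-prime p≢2
  = M , M-cartierManin , M-unique ,
    (λ p≡±1 → M-diagonal (class-±1 p p≡±1)) ,
    (λ p≡±2 → M-antidiagonal (class-±2 p p≡±2)) ,
    Mᵖ∈𝔽ₚ[t]
  where open CartierManin p-prime p≢2 {m} p≡1+2m K-perfectClosure C
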